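{- Let $\mathcal{R}$ be a finite valuation ring of order $q^r$, let $d\ge2$, and let $\mathcal{E}\subseteq\mathcal{R}^d$. If $q^{r-1}\cdot q^{r(d-1)}=o(|\mathcal{E}|)$, then there exists a point $\mathbf{z}\in\mathcal{E}$ such that $|V_d^{\mathbf{z}}(\mathcal{E})|=(1-o(1))q^r$, where \[V_d^{\mathbf{z}}(\mathcal{E})=\{\det(\mathbf{x}^1-\mathbf{z},\ldots,\mathbf{x}^d-\mathbf{z})\colon \mathbf{x}^i\in\mathcal{E},\ 1\le i\le d\}.\]
   Context: $\mathcal{R}$ is a finite valuation ring: a finite commutative local ring with identity whose ideals are totally ordered by inclusion (a finite chain ring); its residue field has $q$ elements, $q$ an odd prime power, and $|\mathcal{R}|=q^r$. $\det(\mathbf{v}_1,\ldots,\mathbf{v}_d)$ is the determinant of the $d\times d$ matrix with columns $\mathbf{v}_1,\ldots,\mathbf{v}_d$. $X=o(Y)$ means $X/Y\to0$ as $q\to\infty$, and $o(1)$ denotes a quantity tending to $0$ as $q\to\infty$. -}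

module Defs where

open import Level using (0ℓ) renaming (suc to lsuc)
open import Algebra.Bundles using (CommutativeRing)
open import Data.Nat as ℕ using (ℕ; zero; suc; _^_; _≤_)
open import Data.Nat.Primality using (Prime)
open import Data.Fin using (Fin; zero; suc; punchIn)
open import Data.List using (List; length)
open import Data.List.Membership.Propositional using (_∈_)
open import Data.List.Relation.Unary.Any using (Any)
open import Data.List.Relation.Unary.AllPairs using (AllPairs)
open import Data.List.Relation.Unary.All using (All)
open import Data.Product using (Σ; ∃; _×_; _,_)
open import Data.Sum using (_⊎_)
open import Relation.Nullary using (¬_)
open import Relation.Binary.PropositionalEquality using (_≡_)
open import Data.Unit using (⊤)

OddPrimePower : ℕ → Set
OddPrimePower q = Σ ℕ λ p → Σ ℕ λ k →
  Prime p × ¬ (p ≡ 2) × 1 ≤ k × q ≡ p ^ k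

module _ (R : CommutativeRing 0ℓ 0ℓ) where
  open CommutativeRing R hiding (zero)

  record Ideal : Set₁ where
    field
      mem     : Carrier → Set
      resp    : ∀ {x y} → x ≈ y → mem x → mem y
      has-0   : mem 0#
      +-closed : ∀ {x y} → mem x → mem y → mem (x + y)
      *-closed : ∀ a {x} → mem x → mem (a * x)
  open Ideal public

  _⊆ᴵ_ : Ideal → Ideal → Set
  I ⊆ᴵ J = ∀ x → mem I x → mem J x

  Proper : Ideal → Set
  Proper I = ¬ mem I 1#

  HasSize : (Carrier → Set) → ℕ → Set
  HasSize S n = Σ (List Carrier) λ xs →
    length xs ≡ n × AllPairs (λ x y → ¬ (x ≈ y)) xs × All S xs ×
    (∀ x → S x → Any (λ y → x ≈ y) xs)

  record IsFiniteValuationRing (q r : ℕ) : Set₁ where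
    field
      card      : HasSize (λ _ → ⊤) (q ^ r)
      𝔪         : Ideal
      𝔪-proper  : Proper 𝔪
      𝔪-max     : ∀ I → Proper I → I ⊆ᴵ 𝔪
      chain     : ∀ I J → I ⊆ᴵ J ⊎ J ⊆ᴵ I
      -- the residue field R/𝔪 has q elements: a complete system of q
      -- pairwise incongruent representatives modulo 𝔪
      residue   : Σ (List Carrier) λ reps →
        length reps ≡ q ×
        AllPairs (λ x y → ¬ mem 𝔪 (x - y)) reps ×
        (∀ x → Any (λ y → mem 𝔪 (x - y)) reps)

  Vec : ℕ → Set
  Vec d = Fin d → Carrier

  _≈ᵥ_ : ∀ {d} → Vec d → Vec d → Set
  u ≈ᵥ v = ∀ i → u i ≈ v i

  _-ᵥ_ : ∀ {d} → Vec d → Vec d → Vec d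
  (u -ᵥ v) i = u i - v i

  ∑ : ∀ {n} → (Fin n → Carrier) → Carrier
  ∑ {zero}  f = 0#
  ∑ {suc n} f = f zero + ∑ (λ i → f (suc i))

  altSign : ∀ {n} → Fin n → Carrier
  altSign zero    = 1#
  altSign (suc i) = - altSign i

  det : ∀ {n} → (Fin n → Fin n → Carrier) → Carrier
  det {zero}  M = 1#
  det {suc n} M = ∑ λ j → altSign j * (M zero j * det (λ i k → M (suc i) (punchIn j k)))

  detCols : ∀ {d} → (Fin d → Vec d) → Carrier
  detCols v = det (λ i j → v j i)

  record Subset (d : ℕ) : Set where
    field
      pts      : List (Vec d)
      distinct : AllPairs (λ x y → ¬ (x ≈ᵥ y)) pts
  open Subset public

  size : ∀ {d} → Subset d → ℕ
  size E = length (pts E)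

  V : ∀ {d} → Subset d → Vec d → Carrier → Set
  V {d} E z c = Σ (Fin d → Vec d) λ x →
    (∀ i → x i ∈ pts E) × (c ≈ detCols (λ i → x i -ᵥ z))

{-# OPTIONS --safe #-}

-- Let N = |R| and, for a ∈ R^(d-1), lin a x = x₀ + Σ aᵢ xᵢ.  Because ideals form a chain, the number
-- of a with lin a w = 0 is at most N^(d-2) times the number of b ∈ R with b w = 0.  Summing over
-- w = x - y with x, y ∈ E, the average over a of the number of pairs with lin a x = lin a y is
-- at most |E|²/N + (|E|/N) Σ |Ann b|^d, the sum running over b ≠ 0.  There |Ann b| ≤ N/q, and
-- Σ |Ann b| ≤ (r+1) N since every b is associated to one of 1, π, …, π^r = 0; so the second term
-- is at most (r+1) |E| N^(d-1)/q, which is negligible when |E| is large compared with N^d/q.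
-- By Cauchy–Schwarz some lin a takes almost N values on E.
-- For this a, some hyperplane lin a = c contains more than N^(d-1)/q points of E, too many to be
-- affinely dependent modulo the maximal ideal, hence points z, x¹, …, x^(d-1) for which the
-- determinant u of the differences, first coordinates dropped, is a unit.  Then
-- det(x - z, x¹ - z, …) = (lin a x - lin a z) u, which takes as many values on E as lin a.
module Submission where

open import Defs
open import Level using (0ℓ)
open import Algebra.Bundles using (CommutativeRing)
open import Data.Nat using (ℕ; zero; suc; _+_; _≤_; _<_; _*_; _^_; _∸_; z≤n; s≤s; >-nonZero)
import Data.Nat.Properties as ℕ
open import Data.Nat.Solver using (module +-*-Solver)
open import Data.Bool using (if_then_else_; true; false)
open import Data.Empty using (⊥-elim)
open import Data.Fin using (Fin; zero; suc; punchIn)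
import Data.Fin.Properties as Fin
open import Data.List using (List; []; _∷_; _++_; length; map; concatMap; filter; upTo)
open import Data.List.Properties using (length-map; length-upTo)
open import Data.List.Membership.Propositional using (_∈_; find; lose)
import Data.List.Membership.Propositional.Properties as ∈
open import Data.List.Relation.Unary.Any using (Any; here; there; any?)
open import Data.List.Relation.Unary.All using (All; []; _∷_)
import Data.List.Relation.Unary.All as All
import Data.List.Relation.Unary.All.Properties as AllP
open import Data.List.Relation.Unary.AllPairs using (AllPairs; []; _∷_)
import Data.List.Relation.Unary.AllPairs as AllPairs
import Data.List.Relation.Unary.AllPairs.Properties as AllPairsP
open import Data.Product using (Σ; _×_; _,_; proj₁; proj₂)
open import Data.Sum using (_⊎_; inj₁; inj₂)
open import Data.Unit using (tt)
open import Data.Vec.Functional using (tail) renaming (_∷_ to _∷ᵛ_; [] to []ᵛ)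
open import Relation.Nullary using (¬_; Dec; yes; no; does)
open import Relation.Nullary.Decidable using (map′; ¬?; decidable-stable)
open import Relation.Binary.Bundles using (DecSetoid)
open import Relation.Binary.PropositionalEquality as ≡ using (_≡_)
import Algebra.Properties.Ring as RingProperties
import Algebra.Solver.Ring.NaturalCoefficients.Default as SemiringSolver
import Relation.Binary.Reasoning.Setoid as SetoidReasoning

private
  variable
    n : ℕ

-- Finite sums of natural numbers

module ListSums where
  open import Data.Nat.Properties hiding (_≟_)
  open import Relation.Binary.PropositionalEquality using (refl; sym; trans; cong; cong₂; subst; module ≡-Reasoning)

  private
    variable
      A B P Q : Set

  -- The Iverson bracket: cardinalities become sums, and double counting becomes an exchange of
  -- summations.
  ⟦_⟧ : Dec P → ℕ
  ⟦ p ⟧ = if does p then 1 else 0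

  ⟦⟧-mono : (P → Q) → (p : Dec P) (q : Dec Q) → ⟦ p ⟧ ≤ ⟦ q ⟧
  ⟦⟧-mono f (yes p) (yes q) = ≤-refl
  ⟦⟧-mono f (yes p) (no ¬q) = ⊥-elim (¬q (f p))
  ⟦⟧-mono f (no ¬p) q = z≤n

  ⟦⟧-cong : (P → Q) → (Q → P) → (p : Dec P) (q : Dec Q) → ⟦ p ⟧ ≡ ⟦ q ⟧
  ⟦⟧-cong f g p q = ≤-antisym (⟦⟧-mono f p q) (⟦⟧-mono g q p)

  ⟦⟧≤1 : (p : Dec P) → ⟦ p ⟧ ≤ 1
  ⟦⟧≤1 (yes _) = ≤-refl
  ⟦⟧≤1 (no _) = z≤n

  ⟦⟧-true : P → (p : Dec P) → ⟦ p ⟧ ≡ 1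
  ⟦⟧-true x (yes _) = refl
  ⟦⟧-true x (no ¬p) = ⊥-elim (¬p x)

  ⟦⟧-× : {S : Set} → (S → P × Q) → (P → Q → S) →
         (s : Dec S) (p : Dec P) (q : Dec Q) → ⟦ s ⟧ ≡ ⟦ p ⟧ * ⟦ q ⟧
  ⟦⟧-× f g s (yes p) (yes q) = ⟦⟧-true (g p q) s
  ⟦⟧-× f g (yes s) (yes p) (no ¬q) = ⊥-elim (¬q (proj₂ (f s)))
  ⟦⟧-× f g (no _) (yes p) (no ¬q) = refl
  ⟦⟧-× f g (yes s) (no ¬p) q = ⊥-elim (¬p (proj₁ (f s)))
  ⟦⟧-× f g (no _) (no ¬p) q = refl

  sumOver : List A → (A → ℕ) → ℕ
  sumOver []       f = 0
  sumOver (x ∷ xs) f = f x + sumOver xs f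

  syntax sumOver xs (λ x → e) = ∑[ x ∈ xs ] e

  infix 5 sumOver

  sumOver-mono-∈ : ∀ (xs : List A) {f g : A → ℕ} → (∀ {x} → x ∈ xs → f x ≤ g x) →
                   sumOver xs f ≤ sumOver xs g
  sumOver-mono-∈ []       h = z≤n
  sumOver-mono-∈ (x ∷ xs) h = +-mono-≤ (h (here refl)) (sumOver-mono-∈ xs (λ m → h (there m)))

  sumOver-mono : ∀ (xs : List A) {f g : A → ℕ} → (∀ x → f x ≤ g x) → sumOver xs f ≤ sumOver xs g
  sumOver-mono xs h = sumOver-mono-∈ xs (λ {x} _ → h x)

  sumOver-cong : ∀ (xs : List A) {f g : A → ℕ} → (∀ x → f x ≡ g x) → sumOver xs f ≡ sumOver xs g
  sumOver-cong []       h = refl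
  sumOver-cong (x ∷ xs) h = cong₂ _+_ (h x) (sumOver-cong xs h)

  sumOver-const : ∀ (xs : List A) k → (∑[ _ ∈ xs ] k) ≡ length xs * k
  sumOver-const []       k = refl
  sumOver-const (x ∷ xs) k = cong (k +_) (sumOver-const xs k)

  sumOver-1 : ∀ (xs : List A) → (∑[ _ ∈ xs ] 1) ≡ length xs
  sumOver-1 xs = trans (sumOver-const xs 1) (*-identityʳ _)

  sumOver-+ : ∀ (xs : List A) (f g : A → ℕ) → (∑[ x ∈ xs ] (f x + g x)) ≡ sumOver xs f + sumOver xs g
  sumOver-+ []       f g = refl
  sumOver-+ (x ∷ xs) f g = trans (cong (f x + g x +_) (sumOver-+ xs f g))
    (solve 4 (λ a b c d → (a :+ b) :+ (c :+ d) := (a :+ c) :+ (b :+ d)) refl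
      (f x) (g x) (sumOver xs f) (sumOver xs g))
    where open +-*-Solver

  sumOver-*ˡ : ∀ (xs : List A) k (f : A → ℕ) → (∑[ x ∈ xs ] (k * f x)) ≡ k * sumOver xs f
  sumOver-*ˡ []       k f = sym (*-zeroʳ k)
  sumOver-*ˡ (x ∷ xs) k f = trans (cong (k * f x +_) (sumOver-*ˡ xs k f)) (sym (*-distribˡ-+ k (f x) _))

  sumOver-*ʳ : ∀ (xs : List A) k (f : A → ℕ) → (∑[ x ∈ xs ] (f x * k)) ≡ sumOver xs f * k
  sumOver-*ʳ xs k f = trans (sumOver-cong xs (λ x → *-comm (f x) k))
    (trans (sumOver-*ˡ xs k f) (*-comm k _))

  sumOver-swap : ∀ (xs : List A) (ys : List B) (f : A → B → ℕ) →
                 (∑[ x ∈ xs ] (∑[ y ∈ ys ] f x y)) ≡ (∑[ y ∈ ys ] (∑[ x ∈ xs ] f x y))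
  sumOver-swap []       ys f = sym (trans (sumOver-const ys 0) (*-zeroʳ (length ys)))
  sumOver-swap (x ∷ xs) ys f = trans (cong (sumOver ys (f x) +_) (sumOver-swap xs ys f))
    (sym (sumOver-+ ys (f x) (λ y → ∑[ x ∈ xs ] f x y)))

  sumOver-++ : ∀ (xs ys : List A) (f : A → ℕ) → sumOver (xs ++ ys) f ≡ sumOver xs f + sumOver ys f
  sumOver-++ []       ys f = refl
  sumOver-++ (x ∷ xs) ys f = trans (cong (f x +_) (sumOver-++ xs ys f)) (sym (+-assoc (f x) _ _))

  sumOver-map : ∀ (g : A → B) (xs : List A) (f : B → ℕ) → sumOver (map g xs) f ≡ (∑[ x ∈ xs ] f (g x))
  sumOver-map g []       f = refl
  sumOver-map g (x ∷ xs) f = cong (f (g x) +_) (sumOver-map g xs f)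

  sumOver-concatMap : ∀ (g : A → List B) (xs : List A) (f : B → ℕ) →
                      sumOver (concatMap g xs) f ≡ (∑[ x ∈ xs ] sumOver (g x) f)
  sumOver-concatMap g []       f = refl
  sumOver-concatMap g (x ∷ xs) f = trans (sumOver-++ (g x) (concatMap g xs) f)
    (cong (sumOver (g x) f +_) (sumOver-concatMap g xs f))

  length-filter : ∀ {P : A → Set} (P? : ∀ x → Dec (P x)) (xs : List A) →
                  length (filter P? xs) ≡ (∑[ x ∈ xs ] ⟦ P? x ⟧)
  length-filter P? []       = refl
  length-filter P? (x ∷ xs) with does (P? x)
  ... | true  = cong suc (length-filter P? xs)
  ... | false = length-filter P? xs

  term≤sumOver : ∀ {xs : List A} (f : A → ℕ) {x} → x ∈ xs → f x ≤ sumOver xs f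
  term≤sumOver f (here refl) = m≤m+n _ _
  term≤sumOver {xs = y ∷ _} f (there m) = ≤-trans (term≤sumOver f m) (m≤n+m _ (f y))

  pigeonhole : ∀ (xs : List A) (f : A → ℕ) b → length xs * b < sumOver xs f → Σ A λ x → b < f x
  pigeonhole (x ∷ xs) f b h with b <? f x
  ... | yes b<fx = x , b<fx
  ... | no  b≮fx = pigeonhole xs f b (+-cancelˡ-< b _ _ (<-≤-trans h (+-monoˡ-≤ _ (≮⇒≥ b≮fx))))

  below-average : ∀ (xs : List A) (f : A → ℕ) b → 0 < length xs → sumOver xs f ≤ length xs * b →
                  Σ A λ x → f x ≤ b
  below-average (x ∷ xs) f b _ h with f x ≤? b
  ... | yes fx≤b = x , fx≤b
  -- The recursion ends at one entry, where the average is the value itself; the empty list would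
  -- violate positivity of the length.
  below-average (x ∷ [])     f b _ h | no fx≰b = ⊥-elim (fx≰b (+-cancelʳ-≤ 0 _ _ h))
  below-average (x ∷ y ∷ ys) f b _ h | no fx≰b =
    below-average (y ∷ ys) f b (s≤s z≤n)
      (+-cancelˡ-≤ b _ _ (≤-trans (+-monoˡ-≤ _ (<⇒≤ (≰⇒> fx≰b))) h))

  atMostOne : ∀ {P : A → Set} (P? : ∀ x → Dec (P x)) {xs : List A} →
              AllPairs (λ x y → ¬ (P x × P y)) xs → (∑[ x ∈ xs ] ⟦ P? x ⟧) ≤ 1
  atMostOne P? [] = z≤n
  atMostOne {P = P} P? {x ∷ xs} (px ∷ pxs) with P? x
  ... | no _  = atMostOne P? pxs
  ... | yes p = s≤s (none xs px)
    where
    none : ∀ ys → All (λ y → ¬ (P x × P y)) ys → (∑[ y ∈ ys ] ⟦ P? y ⟧) ≤ 0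
    none []       []       = z≤n
    none (y ∷ ys) (h ∷ hs) with P? y
    ... | yes p′ = ⊥-elim (h (p , p′))
    ... | no _   = none ys hs

  2mn≤m²+n² : ∀ m n → 2 * (m * n) ≤ m * m + n * n
  2mn≤m²+n² m n with ≤-total m n
  ... | inj₁ m≤n = subst (λ n → 2 * (m * n) ≤ m * m + n * n) (m+[n∸m]≡n m≤n) (ordered m _)
    where
    ordered : ∀ m k → 2 * (m * (m + k)) ≤ m * m + (m + k) * (m + k)
    ordered m k = ≤-trans (m≤m+n _ (k * k)) (≤-reflexive
      (solve 2 (λ m k → con 2 :* (m :* (m :+ k)) :+ k :* k := m :* m :+ (m :+ k) :* (m :+ k)) refl m k))
      where open +-*-Solver
  ... | inj₂ n≤m = subst (λ m → 2 * (m * n) ≤ m * m + n * n) (m+[n∸m]≡n n≤m) (ordered n _)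
    where
    ordered : ∀ n k → 2 * ((n + k) * n) ≤ (n + k) * (n + k) + n * n
    ordered n k = ≤-trans (m≤m+n _ (k * k)) (≤-reflexive
      (solve 2 (λ n k → con 2 :* ((n :+ k) :* n) :+ k :* k := (n :+ k) :* (n :+ k) :+ n :* n) refl n k))
      where open +-*-Solver

  -- With `χ` equal to 1 wherever `f` is nonzero, this bounds the support of `f` from below. In the
  -- induction, expanding the square leaves the cross term `2 * k * F`, which is bounded entry by
  -- entry by `2mn≤m²+n²`.
  cauchySchwarz : ∀ (xs : List A) (f χ : A → ℕ) → (∀ x → f x ≡ 0 ⊎ χ x ≡ 1) →
                  sumOver xs f * sumOver xs f ≤ sumOver xs χ * (∑[ x ∈ xs ] (f x * f x))
  cauchySchwarz []       f χ h = z≤n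
  cauchySchwarz {A = A} (x ∷ xs) f χ h = step (h x)
    where
    open ≤-Reasoning
    F = sumOver xs f
    X = sumOver xs χ
    G = ∑[ x ∈ xs ] (f x * f x)
    term : ∀ k y → f y ≡ 0 ⊎ χ y ≡ 1 → 2 * k * f y ≤ f y * f y + χ y * (k * k)
    term k y (inj₁ e) rewrite e | *-zeroʳ (2 * k) = z≤n
    term k y (inj₂ e) rewrite e | *-identityˡ (k * k) | *-assoc 2 k (f y) | +-comm (f y * f y) (k * k) =
      2mn≤m²+n² k (f y)
    cross : ∀ k → 2 * k * F ≤ G + X * (k * k)
    cross k = begin
      2 * k * F                                       ≡⟨ sumOver-*ˡ xs (2 * k) f ⟨
      (∑[ y ∈ xs ] (2 * k * f y))                     ≤⟨ sumOver-mono xs (λ y → term k y (h y)) ⟩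
      (∑[ y ∈ xs ] (f y * f y + χ y * (k * k)))       ≡⟨ sumOver-+ xs _ _ ⟩
      G + (∑[ y ∈ xs ] (χ y * (k * k)))               ≡⟨ cong (G +_) (sumOver-*ʳ xs (k * k) χ) ⟩
      G + X * (k * k)                                 ∎
    step : f x ≡ 0 ⊎ χ x ≡ 1 → (f x + F) * (f x + F) ≤ (χ x + X) * (f x * f x + G)
    step (inj₁ e) rewrite e = ≤-trans (cauchySchwarz xs f χ h) (*-monoˡ-≤ G (m≤n+m X (χ x)))
    step (inj₂ e) rewrite e = begin
      (k + F) * (k + F)                       ≡⟨ solve 2 (λ k F → (k :+ F) :* (k :+ F) := k :* k :+ con 2 :* k :* F :+ F :* F) refl k F ⟩
      k * k + 2 * k * F + F * F               ≤⟨ +-mono-≤ (+-monoʳ-≤ (k * k) (cross k)) (cauchySchwarz xs f χ h) ⟩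
      k * k + (G + X * (k * k)) + X * G       ≡⟨ solve 3 (λ k G X → k :* k :+ (G :+ X :* (k :* k)) :+ X :* G := (con 1 :+ X) :* (k :* k :+ G)) refl k G X ⟩
      (1 + X) * (k * k + G)                   ∎
      where
      open +-*-Solver
      k = f x

  -- Changes of variable in sums over an enumerated setoid

  module Enumeration (S : DecSetoid 0ℓ 0ℓ) where
    open DecSetoid S using (Carrier; _≈_; _≟_)
    module ≈ = DecSetoid S

    -- Completeness and absence of repetitions in a single count, the form in which they are used
    -- after exchanging sums.
    Enumerates : List Carrier → Set
    Enumerates xs = ∀ t → (∑[ x ∈ xs ] ⟦ x ≟ t ⟧) ≡ 1

    Distinct : List Carrier → Set
    Distinct = AllPairs (λ x y → ¬ (x ≈ y))

    count≤1 : ∀ {xs} → Distinct xs → ∀ t → (∑[ x ∈ xs ] ⟦ x ≟ t ⟧) ≤ 1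
    count≤1 dis t = atMostOne (_≟ t)
      (AllPairs.map (λ x≉y (x≈t , y≈t) → x≉y (≈.trans x≈t (≈.sym y≈t))) dis)

    1≤count : ∀ {xs t} → Any (t ≈_) xs → 1 ≤ (∑[ x ∈ xs ] ⟦ x ≟ t ⟧)
    1≤count {x ∷ xs} {t} (here t≈x) rewrite ⟦⟧-true (≈.sym t≈x) (x ≟ t) = s≤s z≤n
    1≤count {x ∷ xs} {t} (there m)  = ≤-trans (1≤count m) (m≤n+m _ ⟦ x ≟ t ⟧)

    enumerates : ∀ {xs} → Distinct xs → (∀ t → Any (t ≈_) xs) → Enumerates xs
    enumerates dis all t = ≤-antisym (count≤1 dis t) (1≤count (all t))

    Respects : (Carrier → ℕ) → Set
    Respects f = ∀ {x y} → x ≈ y → f x ≡ f y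

    private
      select : ∀ {f} → Respects f → ∀ t x → ⟦ x ≟ t ⟧ * f x ≡ ⟦ x ≟ t ⟧ * f t
      select resp t x with x ≟ t
      ... | yes x≈t = cong (1 *_) (resp x≈t)
      ... | no _    = refl

    sumOver-δ : ∀ {xs} → Enumerates xs → ∀ {f} → Respects f → ∀ t →
                (∑[ x ∈ xs ] (⟦ x ≟ t ⟧ * f x)) ≡ f t
    sumOver-δ {xs} enum {f} resp t = begin
      (∑[ x ∈ xs ] (⟦ x ≟ t ⟧ * f x))  ≡⟨ sumOver-cong xs (select resp t) ⟩
      (∑[ x ∈ xs ] (⟦ x ≟ t ⟧ * f t))  ≡⟨ sumOver-*ʳ xs (f t) _ ⟩
      (∑[ x ∈ xs ] ⟦ x ≟ t ⟧) * f t    ≡⟨ cong (_* f t) (enum t) ⟩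
      1 * f t                          ≡⟨ *-identityˡ (f t) ⟩
      f t                              ∎
      where open ≡-Reasoning

    -- Write each `f y` as a delta sum over `xs` and exchange the sums; every `x` then meets at most
    -- one entry of `ys`.
    sumOver-⊆ : ∀ {xs ys} → Enumerates xs → Distinct ys → ∀ {f} → Respects f → sumOver ys f ≤ sumOver xs f
    sumOver-⊆ {xs} {ys} enum dis {f} resp = begin
      sumOver ys f                                          ≡⟨ sumOver-cong ys (sumOver-δ {xs} enum resp) ⟨
      (∑[ y ∈ ys ] (∑[ x ∈ xs ] (⟦ x ≟ y ⟧ * f x)))         ≡⟨ sumOver-swap ys xs _ ⟩
      (∑[ x ∈ xs ] (∑[ y ∈ ys ] (⟦ x ≟ y ⟧ * f x)))         ≡⟨ sumOver-cong xs (λ x → sumOver-*ʳ ys (f x) _) ⟩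
      (∑[ x ∈ xs ] ((∑[ y ∈ ys ] ⟦ x ≟ y ⟧) * f x))         ≤⟨ sumOver-mono xs (λ x → *-monoˡ-≤ (f x) (atMost x)) ⟩
      (∑[ x ∈ xs ] (1 * f x))                               ≡⟨ sumOver-cong xs (λ x → *-identityˡ (f x)) ⟩
      sumOver xs f                                          ∎
      where
      open ≤-Reasoning
      atMost : ∀ x → (∑[ y ∈ ys ] ⟦ x ≟ y ⟧) ≤ 1
      atMost x = ≤-trans (≤-reflexive (sumOver-cong ys (λ y → ⟦⟧-cong ≈.sym ≈.sym (x ≟ y) (y ≟ x)))) (count≤1 dis x)

    -- The two implications make `φ` and `ψ` mutually inverse and also encode that both respect `≈`.
    -- After a delta is inserted, each fibre of `φ` is counted as the single point `ψ y`.
    sumOver-reindex : ∀ {xs} → Enumerates xs → ∀ {f} → Respects f → (φ ψ : Carrier → Carrier) →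
                      (∀ {x y} → φ x ≈ y → ψ y ≈ x) → (∀ {x y} → ψ y ≈ x → φ x ≈ y) →
                      (∑[ x ∈ xs ] f (φ x)) ≡ sumOver xs f
    sumOver-reindex {xs} enum {f} resp φ ψ to from = begin
      (∑[ x ∈ xs ] f (φ x))                                 ≡⟨ sumOver-cong xs (λ x → sym (sumOver-δ {xs} enum resp (φ x))) ⟩
      (∑[ x ∈ xs ] (∑[ y ∈ xs ] (⟦ y ≟ φ x ⟧ * f y)))       ≡⟨ sumOver-swap xs xs _ ⟩
      (∑[ y ∈ xs ] (∑[ x ∈ xs ] (⟦ y ≟ φ x ⟧ * f y)))       ≡⟨ sumOver-cong xs (λ y → sumOver-*ʳ xs (f y) _) ⟩
      (∑[ y ∈ xs ] ((∑[ x ∈ xs ] ⟦ y ≟ φ x ⟧) * f y))       ≡⟨ sumOver-cong xs (λ y → cong (_* f y) (fibre y)) ⟩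
      (∑[ y ∈ xs ] (1 * f y))                               ≡⟨ sumOver-cong xs (λ y → *-identityˡ (f y)) ⟩
      sumOver xs f                                          ∎
      where
      open ≡-Reasoning
      fibre : ∀ y → (∑[ x ∈ xs ] ⟦ y ≟ φ x ⟧) ≡ 1
      fibre y = trans (sumOver-cong xs (λ x → ⟦⟧-cong (λ e → ≈.sym (to (≈.sym e))) (λ e → ≈.sym (from (≈.sym e))) (y ≟ φ x) (x ≟ ψ y))) (enum (ψ y))

open ListSums

-- Determinants

module RingSums (R : CommutativeRing 0ℓ 0ℓ) where
  open CommutativeRing R hiding (zero) renaming (_+_ to _⊕_; _*_ to _⊗_; -_ to ⊖_; _-_ to _⊝_)
  open RingProperties ring
  open SetoidReasoning setoid
  open SemiringSolver commutativeSemiring using (solve; _:=_; _:+_; _:*_)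

  -- Opaque, so that unification can read the summand off a sum.
  opaque
    sum : (Fin n → Carrier) → Carrier
    sum = ∑ R

    sum-∑ : (f : Fin n → Carrier) → ∑ R f ≈ sum f
    sum-∑ f = refl

    sum-empty : (f : Fin 0 → Carrier) → sum f ≈ 0#
    sum-empty f = refl

    sum-suc : (f : Fin (suc n) → Carrier) → sum f ≈ f zero ⊕ sum (λ i → f (suc i))
    sum-suc f = refl

    sum-cong : {f g : Fin n → Carrier} → (∀ i → f i ≈ g i) → sum f ≈ sum g
    sum-cong {zero}  h = refl
    sum-cong {suc n} h = +-cong (h zero) (sum-cong (λ i → h (suc i)))

    sum-zero : {f : Fin n → Carrier} → (∀ i → f i ≈ 0#) → sum f ≈ 0#
    sum-zero {zero}  h = refl
    sum-zero {suc n} h = trans (+-cong (h zero) (sum-zero (λ i → h (suc i)))) (+-identityˡ 0#)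

    sum-+ : (f g : Fin n → Carrier) → sum (λ i → f i ⊕ g i) ≈ sum f ⊕ sum g
    sum-+ {zero}  f g = sym (+-identityˡ 0#)
    sum-+ {suc n} f g = trans (+-congˡ (sum-+ (λ i → f (suc i)) (λ i → g (suc i))))
      (solve 4 (λ a b c d → (a :+ b) :+ (c :+ d) := (a :+ c) :+ (b :+ d)) refl _ _ _ _)

    sum-*ˡ : ∀ c (f : Fin n → Carrier) → sum (λ i → c ⊗ f i) ≈ c ⊗ sum f
    sum-*ˡ {zero}  c f = sym (zeroʳ c)
    sum-*ˡ {suc n} c f = trans (+-congˡ (sum-*ˡ c (λ i → f (suc i)))) (sym (distribˡ c _ _))

  sum-swap : ∀ {m} (f : Fin m → Fin n → Carrier) →
             sum (λ i → sum (f i)) ≈ sum (λ j → sum (λ i → f i j))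
  sum-swap {m = zero}  f = trans (sum-empty _) (sym (sum-zero (λ _ → sum-empty _)))
  sum-swap {m = suc m} f = begin
    sum (λ i → sum (f i))                                    ≈⟨ sum-suc _ ⟩
    sum (f zero) ⊕ sum (λ i → sum (f (suc i)))               ≈⟨ +-congˡ (sum-swap (λ i → f (suc i))) ⟩
    sum (f zero) ⊕ sum (λ j → sum (λ i → f (suc i) j))       ≈⟨ sum-+ _ _ ⟨
    sum (λ j → f zero j ⊕ sum (λ i → f (suc i) j))           ≈⟨ sum-cong (λ j → sum-suc _) ⟨
    sum (λ j → sum (λ i → f i j))                            ∎

  sum-⊝ : (f g : Fin n → Carrier) → sum (λ i → f i ⊝ g i) ≈ sum f ⊝ sum g
  sum-⊝ f g = trans (sum-+ f (λ i → ⊖ g i)) (+-congˡ (begin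
    sum (λ i → ⊖ g i)         ≈⟨ sum-cong (λ i → sym (-1*x≈-x (g i))) ⟩
    sum (λ i → ⊖ 1# ⊗ g i)    ≈⟨ sum-*ˡ (⊖ 1#) g ⟩
    ⊖ 1# ⊗ sum g              ≈⟨ -1*x≈-x _ ⟩
    ⊖ sum g                   ∎))

  -- A pair (j , l) stands for the ordered pair of distinct indices (j , punchIn j l);
  -- the other two indices then represent the same two indices in the opposite order.
  data Swapped : Fin (suc n) → Fin n → Fin (suc n) → Fin n → Set where
    first : ∀ {l : Fin (suc n)} → Swapped zero l (suc l) zero
    later : ∀ {j j′ : Fin (suc n)} {l l′ : Fin n} → Swapped j l j′ l′ →
            Swapped (suc j) (suc l) (suc j′) (suc l′)

  -- Pairs containing the index zero cancel through `first`; the remaining ones are pairs from a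
  -- smaller index set and cancel by recursion.
  sum-sum-cancel : (f : Fin (suc n) → Fin n → Carrier) →
                   (∀ {j l j′ l′} → Swapped j l j′ l′ → f j l ⊕ f j′ l′ ≈ 0#) →
                   sum (λ j → sum (f j)) ≈ 0#
  sum-sum-cancel {zero}  f h = sum-zero (λ _ → sum-empty _)
  sum-sum-cancel {suc n} f h = begin
    sum (λ j → sum (f j))
      ≈⟨ sum-suc _ ⟩
    sum (f zero) ⊕ sum (λ j → sum (f (suc j)))
      ≈⟨ +-congˡ (trans (sum-cong (λ j → sum-suc _)) (sum-+ _ _)) ⟩
    sum (f zero) ⊕ (sum (λ j → f (suc j) zero) ⊕ sum (λ j → sum (λ l → f (suc j) (suc l))))
      ≈⟨ +-assoc _ _ _ ⟨
    (sum (f zero) ⊕ sum (λ j → f (suc j) zero)) ⊕ sum (λ j → sum (λ l → f (suc j) (suc l)))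
      ≈⟨ +-cong (trans (sym (sum-+ _ _)) (sum-zero (λ l → h first)))
                (sum-sum-cancel (λ j l → f (suc j) (suc l)) (λ s → h (later s))) ⟩
    0# ⊕ 0#
      ≈⟨ +-identityˡ 0# ⟩
    0# ∎

  swapped-punchIn : ∀ {j l j′ l′} → Swapped {n} j l j′ l′ → punchIn j l ≡ j′
  swapped-punchIn first     = ≡.refl
  swapped-punchIn (later s) = ≡.cong suc (swapped-punchIn s)

  swapped-punchIn′ : ∀ {j l j′ l′} → Swapped {n} j l j′ l′ → punchIn j′ l′ ≡ j
  swapped-punchIn′ first     = ≡.refl
  swapped-punchIn′ (later s) = ≡.cong suc (swapped-punchIn′ s)

  swapped-rest : ∀ {j l j′ l′} → Swapped {suc n} j l j′ l′ → ∀ k →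
                 punchIn j (punchIn l k) ≡ punchIn j′ (punchIn l′ k)
  swapped-rest first     k       = ≡.refl
  swapped-rest (later s) zero    = ≡.refl
  swapped-rest {suc n} (later s) (suc k) = ≡.cong suc (swapped-rest s k)

  -- The exponents of the sign are `l` and `l + 1` for `first`, and each `later` adds 2 to both, so
  -- their parities stay opposite.
  swapped-sign : ∀ {j l j′ l′} → Swapped {n} j l j′ l′ →
                 altSign R j ⊗ altSign R l ≈ ⊖ (altSign R j′ ⊗ altSign R l′)
  swapped-sign (first {l = l}) = begin
    1# ⊗ altSign R l           ≈⟨ *-comm _ _ ⟩
    altSign R l ⊗ 1#           ≈⟨ -‿involutive _ ⟨
    ⊖ ⊖ (altSign R l ⊗ 1#)     ≈⟨ -‿cong (-‿distribˡ-* _ _) ⟩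
    ⊖ (⊖ altSign R l ⊗ 1#)     ∎
  swapped-sign (later {j = j} {j′} {l} {l′} s) = begin
    ⊖ altSign R j ⊗ ⊖ altSign R l        ≈⟨ -x*-y≈x*y _ _ ⟩
    altSign R j ⊗ altSign R l            ≈⟨ swapped-sign s ⟩
    ⊖ (altSign R j′ ⊗ altSign R l′)      ≈⟨ -‿cong (-x*-y≈x*y _ _) ⟨
    ⊖ (⊖ altSign R j′ ⊗ ⊖ altSign R l′)  ∎
    where
    -x*-y≈x*y : ∀ x y → ⊖ x ⊗ ⊖ y ≈ x ⊗ y
    -x*-y≈x*y x y = begin
      ⊖ x ⊗ ⊖ y     ≈⟨ -‿distribˡ-* x (⊖ y) ⟨
      ⊖ (x ⊗ ⊖ y)   ≈⟨ -‿cong (-‿distribʳ-* x y) ⟨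
      ⊖ ⊖ (x ⊗ y)   ≈⟨ -‿involutive _ ⟩
      x ⊗ y         ∎

  det-expand : (M : Fin (suc n) → Vec R (suc n)) →
               det R M ≈ sum (λ j → altSign R j ⊗ (M zero j ⊗ det R (λ i k → M (suc i) (punchIn j k))))
  det-expand M = sum-∑ _

  det-cong : {M M′ : Fin n → Fin n → Carrier} → (∀ i j → M i j ≈ M′ i j) → det R M ≈ det R M′
  det-cong {zero}  h = refl
  det-cong {suc n} {M} {M′} h = begin
    det R M                                                                      ≈⟨ det-expand M ⟩
    sum (λ j → altSign R j ⊗ (M zero j ⊗ det R (λ i k → M (suc i) (punchIn j k))))
      ≈⟨ sum-cong (λ j → *-congˡ (*-cong (h zero j) (det-cong (λ i k → h (suc i) (punchIn j k))))) ⟩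
    sum (λ j → altSign R j ⊗ (M′ zero j ⊗ det R (λ i k → M′ (suc i) (punchIn j k)))) ≈⟨ det-expand M′ ⟨
    det R M′                                                                     ∎

  private
    -- The summand of the Laplace expansion along the first two rows `u` and `v`.
    doubleTerm : (u v : Vec R (suc (suc n))) (M : Fin n → Vec R (suc (suc n))) →
                 Fin (suc (suc n)) → Fin (suc n) → Carrier
    doubleTerm u v M j l = (altSign R j ⊗ altSign R l) ⊗
      ((u j ⊗ v (punchIn j l)) ⊗ det R (λ i k → M i (punchIn j (punchIn l k))))

    det-double : (u v : Vec R (suc (suc n))) (M : Fin n → Vec R (suc (suc n))) →
                 det R (u ∷ᵛ v ∷ᵛ M) ≈ sum (λ j → sum (doubleTerm u v M j))
    det-double u v M = trans (det-expand (u ∷ᵛ v ∷ᵛ M)) (sum-cong λ j → begin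
      altSign R j ⊗ (u j ⊗ det R (λ i k → (v ∷ᵛ M) i (punchIn j k)))
        ≈⟨ *-assoc _ _ _ ⟨
      (altSign R j ⊗ u j) ⊗ det R (λ i k → (v ∷ᵛ M) i (punchIn j k))
        ≈⟨ *-congˡ (det-expand (λ i k → (v ∷ᵛ M) i (punchIn j k))) ⟩
      (altSign R j ⊗ u j) ⊗ sum (λ l → altSign R l ⊗ (v (punchIn j l) ⊗ det R (λ i k → M i (punchIn j (punchIn l k)))))
        ≈⟨ sum-*ˡ _ _ ⟨
      sum (λ l → (altSign R j ⊗ u j) ⊗ (altSign R l ⊗ (v (punchIn j l) ⊗ det R (λ i k → M i (punchIn j (punchIn l k))))))
        ≈⟨ sum-cong (λ l →
             solve 5 (λ a b c d e → (a :* b) :* (c :* (d :* e)) := (a :* c) :* ((b :* d) :* e)) refl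
               (altSign R j) (u j) (altSign R l) (v (punchIn j l)) _) ⟩
      sum (doubleTerm u v M j) ∎)

    doubleTerm-swap : ∀ (u v : Vec R (suc (suc n))) M {j l j′ l′} → Swapped j l j′ l′ →
                      doubleTerm u v M j l ⊕ doubleTerm v u M j′ l′ ≈ 0#
    doubleTerm-swap u v M {j} {l} {j′} {l′} s = begin
      (altSign R j ⊗ altSign R l) ⊗ X ⊕ Y            ≈⟨ +-congʳ (*-cong (swapped-sign s) X≈X′) ⟩
      ⊖ (altSign R j′ ⊗ altSign R l′) ⊗ X′ ⊕ Y       ≈⟨ +-congʳ (-‿distribˡ-* _ _) ⟨
      ⊖ Y ⊕ Y                                        ≈⟨ -‿inverseˡ Y ⟩
      0#                                             ∎
      where
      X = (u j ⊗ v (punchIn j l)) ⊗ det R (λ i k → M i (punchIn j (punchIn l k)))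
      X′ = (v j′ ⊗ u (punchIn j′ l′)) ⊗ det R (λ i k → M i (punchIn j′ (punchIn l′ k)))
      Y = doubleTerm v u M j′ l′
      X≈X′ : X ≈ X′
      X≈X′ = *-cong
        (trans (*-comm _ _) (*-cong (reflexive (≡.cong v (swapped-punchIn s)))
                                    (reflexive (≡.cong u (≡.sym (swapped-punchIn′ s))))))
        (det-cong (λ i k → reflexive (≡.cong (M i) (swapped-rest s k))))

  det-swap-rows : (u v : Vec R (suc (suc n))) (M : Fin n → Vec R (suc (suc n))) →
                  det R (u ∷ᵛ v ∷ᵛ M) ⊕ det R (v ∷ᵛ u ∷ᵛ M) ≈ 0#
  det-swap-rows u v M = begin
    det R (u ∷ᵛ v ∷ᵛ M) ⊕ det R (v ∷ᵛ u ∷ᵛ M)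
      ≈⟨ +-cong (det-double u v M) (det-double v u M) ⟩
    sum (λ j → sum (doubleTerm u v M j)) ⊕ sum (λ j → sum (doubleTerm v u M j))
      ≈⟨ sum-+ _ _ ⟨
    sum (λ j → sum (doubleTerm u v M j) ⊕ sum (doubleTerm v u M j))
      ≈⟨ sum-cong (λ j → sym (sum-+ _ _)) ⟩
    sum (λ j → sum (λ l → doubleTerm u v M j l ⊕ doubleTerm v u M j l))
      -- The term of one determinant at a pair of indices cancels the term of the other at the
      -- swapped pair.
      ≈⟨ sum-sum-cancel _ (λ {j} {l} {j′} {l′} s → trans
           (solve 4 (λ a b c d → (a :+ b) :+ (c :+ d) := (a :+ d) :+ (b :+ c)) refl _ _ _ _)
           (trans (+-cong (doubleTerm-swap u v M s) (doubleTerm-swap v u M s)) (+-identityˡ 0#))) ⟩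
    0# ∎

  -- If the equal rows are adjacent, the double expansion cancels in pairs, without dividing by 2.
  -- Otherwise swap the first two rows: every minor along the new first row repeats a row, so
  -- induction applies.
  det-repeated-row : (M : Fin n → Vec R (suc n)) (k : Fin n) → det R (M k ∷ᵛ M) ≈ 0#
  det-repeated-row {suc n} M zero = begin
    det R (M zero ∷ᵛ M)                                        ≈⟨ det-double (M zero) (M zero) (λ i → M (suc i)) ⟩
    sum (λ j → sum (doubleTerm (M zero) (M zero) (λ i → M (suc i)) j))
      ≈⟨ sum-sum-cancel _ (doubleTerm-swap (M zero) (M zero) (λ i → M (suc i))) ⟩
    0# ∎
  det-repeated-row {suc n} M (suc k) = begin
    det R (M (suc k) ∷ᵛ M)                     ≈⟨ +-identityʳ _ ⟨
    det R (M (suc k) ∷ᵛ M) ⊕ 0#                ≈⟨ +-congˡ (trans (det-expand (M zero ∷ᵛ M (suc k) ∷ᵛ λ i → M (suc i))) (sum-zero minors-vanish)) ⟨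
    det R (M (suc k) ∷ᵛ M) ⊕ det R (M zero ∷ᵛ M (suc k) ∷ᵛ λ i → M (suc i))
      ≈⟨ det-swap-rows (M (suc k)) (M zero) (λ i → M (suc i)) ⟩
    0# ∎
    where
    minors-vanish : ∀ j → altSign R j ⊗ (M zero j ⊗ det R (λ i l → (M (suc k) ∷ᵛ λ i → M (suc i)) i (punchIn j l))) ≈ 0#
    minors-vanish j = trans (*-congˡ (trans
      (*-congˡ (det-repeated-row (λ i l → M (suc i) (punchIn j l)) k)) (zeroʳ _))) (zeroʳ _)

  -- The leading coefficient is 1, so that replacing the first row of a matrix by this combination
  -- keeps the determinant, and so that the value together with `tail x` recovers `x`.
  lin : Vec R n → Vec R (suc n) → Carrier
  lin a x = x zero ⊕ sum (λ i → a i ⊗ x (suc i))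

  -- By linearity in the first row, each added multiple of a later row contributes a determinant
  -- with a repeated row.
  det-shear : (a : Vec R n) (M : Fin (suc n) → Vec R (suc n)) →
              det R M ≈ det R ((λ j → lin a (λ i → M i j)) ∷ᵛ λ i → M (suc i))
  det-shear {n} a M = sym (begin
    det R ((λ j → lin a (λ i → M i j)) ∷ᵛ λ i → M (suc i))
      ≈⟨ det-expand ((λ j → lin a (λ i → M i j)) ∷ᵛ λ i → M (suc i)) ⟩
    sum (λ j → altSign R j ⊗ (lin a (λ i → M i j) ⊗ minor j))
      ≈⟨ sum-cong (λ j → trans
           (solve 4 (λ s x y m → s :* ((x :+ y) :* m) := s :* (x :* m) :+ (s :* m) :* y) refl
             (altSign R j) (M zero j) _ (minor j))
           (+-congˡ (trans (sym (sum-*ˡ _ _)) (sum-cong λ k →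
             solve 4 (λ s m a y → (s :* m) :* (a :* y) := a :* (s :* (y :* m))) refl
               (altSign R j) (minor j) (a k) (M (suc k) j))))) ⟩
    sum (λ j → altSign R j ⊗ (M zero j ⊗ minor j) ⊕ sum (λ k → a k ⊗ (altSign R j ⊗ (M (suc k) j ⊗ minor j))))
      ≈⟨ trans (sum-+ _ _) (+-congʳ (sym (det-expand M))) ⟩
    det R M ⊕ sum (λ j → sum (λ k → a k ⊗ (altSign R j ⊗ (M (suc k) j ⊗ minor j))))
      ≈⟨ +-congˡ (sum-swap _) ⟩
    det R M ⊕ sum (λ k → sum (λ j → a k ⊗ (altSign R j ⊗ (M (suc k) j ⊗ minor j))))
      ≈⟨ +-congˡ (sum-zero (λ k → trans (sum-*ˡ (a k) _)
           (trans (*-congˡ (trans (sym (det-expand (M (suc k) ∷ᵛ λ i → M (suc i)))) (det-repeated-row (λ i → M (suc i)) k))) (zeroʳ _)))) ⟩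
    det R M ⊕ 0#
      ≈⟨ +-identityʳ _ ⟩
    det R M ∎)
    where
    minor : Fin (suc n) → Carrier
    minor j = det R (λ i k → M (suc i) (punchIn j k))

  det-firstRow : (M : Fin (suc n) → Vec R (suc n)) → (∀ j → M zero (suc j) ≈ 0#) →
                 det R M ≈ M zero zero ⊗ det R (λ i j → M (suc i) (suc j))
  det-firstRow M h = begin
    det R M
      ≈⟨ trans (det-expand M) (sum-suc _) ⟩
    1# ⊗ (M zero zero ⊗ det R (λ i j → M (suc i) (suc j))) ⊕ sum _
      ≈⟨ +-cong (*-identityˡ _) (sum-zero (λ j → trans (*-congˡ (trans (*-congʳ (h j)) (zeroˡ _))) (zeroʳ _))) ⟩
    M zero zero ⊗ det R (λ i j → M (suc i) (suc j)) ⊕ 0#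
      ≈⟨ +-identityʳ _ ⟩
    M zero zero ⊗ det R (λ i j → M (suc i) (suc j)) ∎

  lin-⊝ : (a : Vec R n) (x y : Vec R (suc n)) → lin a (_-ᵥ_ R x y) ≈ lin a x ⊝ lin a y
  lin-⊝ a x y = begin
    (x zero ⊝ y zero) ⊕ sum (λ i → a i ⊗ (x (suc i) ⊝ y (suc i)))
      ≈⟨ +-congˡ (trans (sum-cong (λ i → x[y-z]≈xy-xz _ _ _)) (sum-⊝ _ _)) ⟩
    (x zero ⊝ y zero) ⊕ (X ⊝ Y)
      ≈⟨ solve 4 (λ a b c d → (a :+ b) :+ (c :+ d) := (a :+ c) :+ (b :+ d)) refl _ _ _ _ ⟩
    lin a x ⊕ (⊖ y zero ⊕ ⊖ Y)
      ≈⟨ +-congˡ (-‿+-comm _ _) ⟩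
    lin a x ⊝ lin a y ∎
    where
    X = sum (λ i → a i ⊗ x (suc i))
    Y = sum (λ i → a i ⊗ y (suc i))

-- Counting in finite valuation rings

-- Serves to decide membership in `V`, so that volumes can be counted. The first hypothesis stands
-- in for function extensionality when a tuple is split into head and tail.
tuples? : {A : Set} (n : ℕ) (xs : List A) {P : (Fin n → A) → Set} →
          (∀ {f g} → (∀ i → f i ≡ g i) → P f → P g) → (∀ f → Dec (P f)) →
          Dec (Σ (Fin n → A) λ f → (∀ i → f i ∈ xs) × P f)
tuples? zero    xs resp P? = map′ (λ p → []ᵛ , (λ ()) , p) (λ (f , _ , p) → resp (λ ()) p) (P? []ᵛ)
tuples? {A} (suc n) xs {P} resp P? = map′ extend restrict (any? rest? xs)
  where
  Rest : A → Set
  Rest x = Σ (Fin n → A) λ f → (∀ i → f i ∈ xs) × P (x ∷ᵛ f)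
  rest? : ∀ x → Dec (Rest x)
  rest? x = tuples? n xs (λ f≡g → resp (λ { zero → ≡.refl ; (suc i) → f≡g i })) (λ f → P? (x ∷ᵛ f))
  extend : Any Rest xs → Σ (Fin (suc n) → A) λ f → (∀ i → f i ∈ xs) × P f
  extend a with find a
  ... | x , x∈ , f , f∈ , p = (x ∷ᵛ f) , (λ { zero → x∈ ; (suc i) → f∈ i }) , p
  restrict : (Σ (Fin (suc n) → A) λ f → (∀ i → f i ∈ xs) × P f) → Any Rest xs
  restrict (f , f∈ , p) = lose (f∈ zero)
    (tail f , (λ i → f∈ (suc i)) , resp (λ { zero → ≡.refl ; (suc i) → ≡.refl }) p)

module FiniteValuationRing (R : CommutativeRing 0ℓ 0ℓ) (q r : ℕ) (fvr : IsFiniteValuationRing R q r) where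
  open CommutativeRing R hiding (zero) renaming (_+_ to _⊕_; _*_ to _⊗_; -_ to ⊖_; _-_ to _⊝_)
  open IsFiniteValuationRing fvr
  open RingProperties ring
  open RingSums R
  module ≈-Reasoning = SetoidReasoning setoid
  open SemiringSolver commutativeSemiring using (solve; _:=_; _:+_; _:*_)

  N : ℕ
  N = q ^ r

  elems : List Carrier
  elems = proj₁ card

  private
    elems-distinct : AllPairs (λ x y → ¬ (x ≈ y)) elems
    elems-distinct = proj₁ (proj₂ (proj₂ card))

    elems-complete : ∀ x → Any (x ≈_) elems
    elems-complete x = proj₂ (proj₂ (proj₂ (proj₂ card))) x tt

    -- Two elements are equal exactly if they sit at the same position of the list.
    compare : ∀ {x y xs} → AllPairs (λ x y → ¬ (x ≈ y)) xs →
              Any (x ≈_) xs → Any (y ≈_) xs → Dec (x ≈ y)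
    compare (_ ∷ _)  (here x≈z) (here y≈z) = yes (trans x≈z (sym y≈z))
    compare (_ ∷ ds) (there mx) (there my) = compare ds mx my
    compare (d ∷ _)  (here x≈z) (there my) with find my
    ... | w , w∈ , y≈w = no λ x≈y → All.lookup d w∈ (trans (sym x≈z) (trans x≈y y≈w))
    compare (d ∷ _)  (there mx) (here y≈z) with find mx
    ... | w , w∈ , x≈w = no λ x≈y → All.lookup d w∈ (trans (sym y≈z) (trans (sym x≈y) x≈w))

  infix 4 _≟_ _∣_ _∣?_

  opaque
    _≟_ : ∀ x y → Dec (x ≈ y)
    x ≟ y = compare elems-distinct (elems-complete x) (elems-complete y)

  decSetoid : DecSetoid 0ℓ 0ℓ
  decSetoid = record { isDecEquivalence = record { isEquivalence = isEquivalence ; _≟_ = _≟_ } }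

  vecDecSetoid : ℕ → DecSetoid 0ℓ 0ℓ
  vecDecSetoid n = record
    { Carrier = Vec R n
    ; _≈_ = _≈ᵥ_ R
    ; isDecEquivalence = record
      { isEquivalence = record
        { refl = λ i → refl ; sym = λ e i → sym (e i) ; trans = λ e f i → trans (e i) (f i) }
      ; _≟_ = λ u v → Fin.all? (λ i → u i ≟ v i) } }

  module Elt = Enumeration decSetoid
  module Vct (n : ℕ) = Enumeration (vecDecSetoid n)

  elems-enumerate : Elt.Enumerates elems
  elems-enumerate = Elt.enumerates elems-distinct elems-complete

  sum-elems-1 : (∑[ _ ∈ elems ] 1) ≡ N
  sum-elems-1 = ≡.trans (sumOver-1 elems) (proj₁ (proj₂ card))

  sum-elems-const : ∀ k → (∑[ _ ∈ elems ] k) ≡ N * k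
  sum-elems-const k = ≡.trans (sumOver-const elems k) (≡.cong (_* k) (proj₁ (proj₂ card)))

  sum-elems-≤N : {P : Carrier → Set} (P? : ∀ x → Dec (P x)) → (∑[ x ∈ elems ] ⟦ P? x ⟧) ≤ N
  sum-elems-≤N P? = ℕ.≤-trans (sumOver-mono elems (λ x → ⟦⟧≤1 (P? x))) (ℕ.≤-reflexive sum-elems-1)

  sum-shift : ∀ {f} → Elt.Respects f → ∀ c → (∑[ x ∈ elems ] f (c ⊕ x)) ≡ sumOver elems f
  sum-shift resp c = Elt.sumOver-reindex {elems} elems-enumerate resp (c ⊕_) (⊖ c ⊕_) (cancel c)
    (λ e → trans (+-congʳ (sym (-‿involutive c))) (cancel (⊖ c) e))
    where
    cancel : ∀ c {x y} → c ⊕ x ≈ y → ⊖ c ⊕ y ≈ x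
    cancel c {x} {y} e = begin
      ⊖ c ⊕ y        ≈⟨ +-congˡ e ⟨
      ⊖ c ⊕ (c ⊕ x)  ≈⟨ +-assoc _ _ _ ⟨
      ⊖ c ⊕ c ⊕ x    ≈⟨ +-congʳ (-‿inverseˡ c) ⟩
      0# ⊕ x         ≈⟨ +-identityˡ x ⟩
      x              ∎
      where open ≈-Reasoning

  -- Divisibility, units and annihilators

  _∣_ : Carrier → Carrier → Set
  g ∣ x = Σ Carrier λ h → x ≈ h ⊗ g

  opaque
    _∣?_ : ∀ g x → Dec (g ∣ x)
    g ∣? x = map′
      (λ a → let (h , _ , e) = find a in h , e)
      (λ (h , e) → let (h′ , h′∈ , h≈h′) = find (elems-complete h)
                   in lose h′∈ (trans e (*-congʳ h≈h′)))
      (any? (λ h → x ≟ h ⊗ g) elems)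

  ∣-respʳ : ∀ {g x y} → x ≈ y → g ∣ x → g ∣ y
  ∣-respʳ x≈y (h , e) = h , trans (sym x≈y) e

  ∣-⊝ : ∀ {g x y} → g ∣ x → g ∣ y → g ∣ x ⊝ y
  ∣-⊝ {g} (h , e) (h′ , e′) = h ⊝ h′ , trans (+-cong e (-‿cong e′)) (sym ([y-z]x≈yx-zx g h h′))

  principal : Carrier → Ideal R
  principal g = record
    { mem = g ∣_
    ; resp = ∣-respʳ
    ; has-0 = 0# , sym (zeroˡ g)
    ; +-closed = λ (h , e) (h′ , e′) → h ⊕ h′ , trans (+-cong e e′) (sym (distribʳ g h h′))
    ; *-closed = λ a (h , e) → a ⊗ h , trans (*-congˡ e) (sym (*-assoc a h g)) }

  ∣-refl : ∀ {x} → x ∣ x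
  ∣-refl {x} = 1# , sym (*-identityˡ x)

  ∣-trans : ∀ {x y z} → x ∣ y → y ∣ z → x ∣ z
  ∣-trans (h , e) (h′ , e′) = h′ ⊗ h , trans e′ (trans (*-congˡ e) (sym (*-assoc _ _ _)))

  -- The chain condition applied to principal ideals; inclusion reverses divisibility.
  ∣-total : ∀ x y → x ∣ y ⊎ y ∣ x
  ∣-total x y with chain (principal x) (principal y)
  ... | inj₁ x⊆y = inj₂ (x⊆y x ∣-refl)
  ... | inj₂ y⊆x = inj₁ (y⊆x y ∣-refl)

  Unit : Carrier → Set
  Unit u = u ∣ 1#

  unit-cancel : ∀ {u x} → Unit u → u ⊗ x ≈ 0# → x ≈ 0#
  unit-cancel {u} {x} (v , e) ux≈0 = begin
    x            ≈⟨ *-identityˡ x ⟨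
    1# ⊗ x       ≈⟨ *-congʳ e ⟩
    v ⊗ u ⊗ x    ≈⟨ *-assoc v u x ⟩
    v ⊗ (u ⊗ x)  ≈⟨ *-congˡ ux≈0 ⟩
    v ⊗ 0#       ≈⟨ zeroʳ v ⟩
    0#           ∎
    where open ≈-Reasoning

  -- The ideal generated by a nonunit is proper, hence contained in `𝔪`.
  nonunit⇒𝔪 : ∀ {x} → ¬ Unit x → mem 𝔪 x
  nonunit⇒𝔪 {x} ¬u = 𝔪-max (principal x) ¬u x ∣-refl

  𝔪⇒nonunit : ∀ {x} → mem 𝔪 x → ¬ Unit x
  𝔪⇒nonunit x∈𝔪 (v , e) = 𝔪-proper (resp 𝔪 (sym e) (*-closed 𝔪 v x∈𝔪))

  𝔪-⊝ : ∀ {x y} → mem 𝔪 x → mem 𝔪 y → mem 𝔪 (x ⊝ y)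
  𝔪-⊝ {x} {y} x∈ y∈ = +-closed 𝔪 x∈ (resp 𝔪 (-1*x≈-x y) (*-closed 𝔪 (⊖ 1#) y∈))

  reps : List Carrier
  reps = proj₁ residue

  x-[x-y]≈y : ∀ x y → x ⊝ (x ⊝ y) ≈ y
  x-[x-y]≈y x y = begin
    x ⊕ ⊖ (x ⊕ ⊖ y)      ≈⟨ +-congˡ (-‿+-comm x (⊖ y)) ⟨
    x ⊕ (⊖ x ⊕ ⊖ ⊖ y)    ≈⟨ +-assoc _ _ _ ⟨
    x ⊕ ⊖ x ⊕ ⊖ ⊖ y      ≈⟨ +-cong (-‿inverseʳ x) (-‿involutive y) ⟩
    0# ⊕ y               ≈⟨ +-identityˡ y ⟩
    y                    ∎
    where open ≈-Reasoning

  [x-z]-[x-y]≈y-z : ∀ x y z → (x ⊝ z) ⊝ (x ⊝ y) ≈ y ⊝ z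
  [x-z]-[x-y]≈y-z x y z = begin
    (x ⊕ ⊖ z) ⊕ ⊖ (x ⊝ y)   ≈⟨ solve 3 (λ a b c → (a :+ b) :+ c := (a :+ c) :+ b) refl x (⊖ z) (⊖ (x ⊝ y)) ⟩
    (x ⊕ ⊖ (x ⊝ y)) ⊕ ⊖ z   ≈⟨ +-congʳ (x-[x-y]≈y x y) ⟩
    y ⊝ z                   ∎
    where open ≈-Reasoning

  sum-translate : ∀ {f} → Elt.Respects f → ∀ c → (∑[ x ∈ elems ] f (x ⊝ c)) ≡ sumOver elems f
  sum-translate resp c = ≡.trans (sumOver-cong elems (λ x → resp (+-comm x (⊖ c)))) (sum-shift resp (⊖ c))

  nonunits : ℕ
  nonunits = ∑[ x ∈ elems ] ⟦ ¬? (x ∣? 1#) ⟧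

  private
    -- Under the last hypothesis the q translates of P by ρ g, one for each residue class ρ, are disjoint.
    disjoint-translates : {P Q : Carrier → Set} (P? : ∀ x → Dec (P x)) (Q? : ∀ x → Dec (Q x)) →
      (∀ {x y} → x ≈ y → P x → P y) → ∀ g →
      (∀ x ρ → P (x ⊝ ρ ⊗ g) → Q x) →
      (∀ x ρ ρ′ → P (x ⊝ ρ ⊗ g) → P (x ⊝ ρ′ ⊗ g) → mem 𝔪 (ρ ⊝ ρ′)) →
      q * (∑[ x ∈ elems ] ⟦ P? x ⟧) ≤ (∑[ x ∈ elems ] ⟦ Q? x ⟧)
    disjoint-translates {P} P? Q? P-resp g P⇒Q apart = begin
      q * (∑[ x ∈ elems ] ⟦ P? x ⟧)                       ≡⟨ ≡.cong (_* (∑[ x ∈ elems ] ⟦ P? x ⟧)) (≡.sym (proj₁ (proj₂ residue))) ⟩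
      length reps * (∑[ x ∈ elems ] ⟦ P? x ⟧)             ≡⟨ sumOver-const reps _ ⟨
      (∑[ ρ ∈ reps ] (∑[ x ∈ elems ] ⟦ P? x ⟧))           ≡⟨ sumOver-cong reps (λ ρ → sum-translate P-cong (ρ ⊗ g)) ⟨
      (∑[ ρ ∈ reps ] (∑[ x ∈ elems ] ⟦ P? (x ⊝ ρ ⊗ g) ⟧)) ≡⟨ sumOver-swap reps elems _ ⟩
      (∑[ x ∈ elems ] (∑[ ρ ∈ reps ] ⟦ P? (x ⊝ ρ ⊗ g) ⟧)) ≤⟨ sumOver-mono elems one ⟩
      (∑[ x ∈ elems ] ⟦ Q? x ⟧)                           ∎
      where
      open ℕ.≤-Reasoning
      P-cong : Elt.Respects (λ x → ⟦ P? x ⟧)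
      P-cong {x} {y} e = ⟦⟧-cong (P-resp e) (P-resp (sym e)) (P? x) (P? y)
      one : ∀ x → (∑[ ρ ∈ reps ] ⟦ P? (x ⊝ ρ ⊗ g) ⟧) ≤ ⟦ Q? x ⟧
      one x with Q? x
      ... | yes _ = atMostOne (λ ρ → P? (x ⊝ ρ ⊗ g))
        (AllPairs.map (λ ρ≢ρ′ (p , p′) → ρ≢ρ′ (apart x _ _ p p′)) (proj₁ (proj₂ (proj₂ residue))))
      ... | no ¬q = ℕ.≤-trans
        (sumOver-mono reps (λ ρ → ⟦⟧-mono (λ p → ¬q (P⇒Q x ρ p)) (P? (x ⊝ ρ ⊗ g)) (no (λ ()))))
        (ℕ.≤-reflexive (≡.trans (sumOver-const reps 0) (ℕ.*-zeroʳ (length reps))))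

  -- If `x - ρ` and `x - ρ′` are both nonunits, their difference puts `ρ - ρ′` in `𝔪`; so the
  -- translates of the nonunits by representatives are disjoint.
  q*nonunits≤N : q * nonunits ≤ N
  q*nonunits≤N = ℕ.≤-trans
    (disjoint-translates (λ x → ¬? (x ∣? 1#)) (λ _ → yes tt)
      (λ x≈y ¬u (v , e) → ¬u (v , trans e (*-congˡ (sym x≈y)))) 1# (λ _ _ _ → tt)
      (λ x ρ ρ′ p p′ → resp 𝔪
        (trans ([x-z]-[x-y]≈y-z x _ _) (+-cong (*-identityʳ ρ) (-‿cong (*-identityʳ ρ′))))
        (𝔪-⊝ (nonunit⇒𝔪 p′) (nonunit⇒𝔪 p))))
    (ℕ.≤-reflexive sum-elems-1)

  annihilators : Carrier → ℕ
  annihilators g = ∑[ x ∈ elems ] ⟦ g ⊗ x ≟ 0# ⟧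

  -- A unit cannot annihilate a nonzero element, so the annihilator consists of nonunits.
  q*annihilators≤N : ∀ {g} → ¬ (g ≈ 0#) → q * annihilators g ≤ N
  q*annihilators≤N {g} g≉0 = ℕ.≤-trans
    (ℕ.*-monoʳ-≤ q (sumOver-mono elems (λ x → ⟦⟧-mono
      (λ gx≈0 u → g≉0 (unit-cancel u (trans (*-comm x g) gx≈0))) (g ⊗ x ≟ 0#) (¬? (x ∣? 1#)))))
    q*nonunits≤N

  -- The solutions form a coset of the annihilator through the known quotient `h`.
  fibre-size : ∀ {g y} → g ∣ y → (∑[ x ∈ elems ] ⟦ x ⊗ g ≟ y ⟧) ≡ annihilators g
  fibre-size {g} {y} (h , e) = ≡.trans
    (≡.sym (sum-shift (λ {x} {x′} x≈x′ → ⟦⟧-cong (trans (*-congʳ (sym x≈x′))) (trans (*-congʳ x≈x′)) (x ⊗ g ≟ y) (x′ ⊗ g ≟ y)) h))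
    (sumOver-cong elems (λ x → ⟦⟧-cong
      (λ e′ → trans (*-comm g x) (+-cancelˡ (h ⊗ g) _ _
        (trans (sym (distribʳ g h x)) (trans e′ (trans e (sym (+-identityʳ _)))))))
      (λ gx≈0 → trans (distribʳ g h x) (trans (+-congˡ (trans (*-comm x g) gx≈0)) (trans (+-identityʳ _) (sym e))))
      ((h ⊕ x) ⊗ g ≟ y) (g ⊗ x ≟ 0#)))

  multiples : Carrier → ℕ
  multiples g = ∑[ x ∈ elems ] ⟦ g ∣? x ⟧

  -- Multiplication by `g` has a fibre of size `annihilators g` over each multiple, and these fibres
  -- are disjoint.
  multiples*annihilators≤N : ∀ g → multiples g * annihilators g ≤ N
  multiples*annihilators≤N g = begin
    multiples g * annihilators g                          ≡⟨ sumOver-*ʳ elems _ _ ⟨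
    (∑[ y ∈ elems ] (⟦ g ∣? y ⟧ * annihilators g))        ≤⟨ sumOver-mono elems fibre ⟩
    (∑[ y ∈ elems ] (∑[ x ∈ elems ] ⟦ x ⊗ g ≟ y ⟧))       ≡⟨ sumOver-swap elems elems _ ⟩
    (∑[ x ∈ elems ] (∑[ y ∈ elems ] ⟦ x ⊗ g ≟ y ⟧))       ≡⟨ sumOver-cong elems (λ x → ≡.trans (sumOver-cong elems (λ y → ⟦⟧-cong sym sym (x ⊗ g ≟ y) (y ≟ x ⊗ g))) (elems-enumerate (x ⊗ g))) ⟩
    (∑[ x ∈ elems ] 1)                                    ≡⟨ sum-elems-1 ⟩
    N                                                     ∎
    where
    open ℕ.≤-Reasoning
    fibre : ∀ y → ⟦ g ∣? y ⟧ * annihilators g ≤ (∑[ x ∈ elems ] ⟦ x ⊗ g ≟ y ⟧)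
    fibre y with g ∣? y
    ... | yes g∣y = ℕ.≤-reflexive (≡.trans (ℕ.*-identityˡ _) (≡.sym (fibre-size g∣y)))
    ... | no _    = z≤n

  -- Powers of a uniformiser

  0-nonunit : ¬ Unit 0#
  0-nonunit = 𝔪⇒nonunit (has-0 𝔪)

  private
    -- Scan the list and keep a nonunit dividing all nonunits met so far; since divisibility is
    -- total, a new nonunit is either divisible by it or replaces it. The scan starts from 0.
    uniformiser-of : ∀ xs → Σ Carrier λ g → ¬ Unit g × All (λ x → ¬ Unit x → g ∣ x) xs
    uniformiser-of [] = 0# , 0-nonunit , []
    uniformiser-of (x ∷ xs) with uniformiser-of xs | x ∣? 1#
    ... | g , g∤1 , all | yes x∣1 = g , g∤1 , (λ x∤1 → ⊥-elim (x∤1 x∣1)) ∷ all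
    ... | g , g∤1 , all | no x∤1 with ∣-total g x
    ...   | inj₁ g∣x = g , g∤1 , (λ _ → g∣x) ∷ all
    ...   | inj₂ x∣g = x , x∤1 , (λ _ → ∣-refl) ∷ All.map (λ f y∤1 → ∣-trans x∣g (f y∤1)) all

  π : Carrier
  π = proj₁ (uniformiser-of elems)

  π∈𝔪 : mem 𝔪 π
  π∈𝔪 = nonunit⇒𝔪 (proj₁ (proj₂ (uniformiser-of elems)))

  π∣nonunit : ∀ {x} → ¬ Unit x → π ∣ x
  π∣nonunit {x} x∤1 with find (elems-complete x)
  ... | y , y∈ , x≈y = ∣-respʳ (sym x≈y) (All.lookup (proj₂ (proj₂ (uniformiser-of elems))) y∈
    (λ (v , e) → x∤1 (v , trans e (*-congˡ (sym x≈y)))))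

  infix 9 π^_
  π^_ : ℕ → Carrier
  π^ zero  = 1#
  π^ suc k = π ⊗ π^ k

  -- The translates of the ideal of `π ⊗ g` by `ρ ⊗ g` lie in that of `g`. If two of them meet, then
  -- `ρ - ρ′ - h π` kills the nonzero `g` for some `h`, so it lies in `𝔪`, and with it `ρ - ρ′`.
  q*multiples-π≤multiples : ∀ {g} → ¬ (g ≈ 0#) → q * multiples (π ⊗ g) ≤ multiples g
  q*multiples-π≤multiples {g} g≉0 =
    disjoint-translates ((π ⊗ g) ∣?_) (g ∣?_) ∣-respʳ g
      (λ x ρ πg∣ → ∣-respʳ (x-y+y≈x x (ρ ⊗ g)) (+-closed (principal g) (∣-trans (π , refl) πg∣) (ρ , refl)))
      apart
    where
    open ≈-Reasoning
    x-y+y≈x : ∀ x y → (x ⊝ y) ⊕ y ≈ x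
    x-y+y≈x x y = trans (+-assoc x (⊖ y) y) (trans (+-congˡ (-‿inverseˡ y)) (+-identityʳ x))
    apart : ∀ x ρ ρ′ → π ⊗ g ∣ x ⊝ ρ ⊗ g → π ⊗ g ∣ x ⊝ ρ′ ⊗ g → mem 𝔪 (ρ ⊝ ρ′)
    apart x ρ ρ′ p p′ with ∣-⊝ p′ p
    ... | h , e = resp 𝔪 (x-y+y≈x (ρ ⊝ ρ′) (h ⊗ π))
      (+-closed 𝔪 (nonunit⇒𝔪 (λ u → g≉0 (unit-cancel u kills))) (*-closed 𝔪 h π∈𝔪))
      where
      kills : ((ρ ⊝ ρ′) ⊝ h ⊗ π) ⊗ g ≈ 0#
      kills = begin
        ((ρ ⊝ ρ′) ⊝ h ⊗ π) ⊗ g             ≈⟨ [y-z]x≈yx-zx g _ _ ⟩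
        (ρ ⊝ ρ′) ⊗ g ⊝ h ⊗ π ⊗ g           ≈⟨ +-cong ([y-z]x≈yx-zx g ρ ρ′) (-‿cong (*-assoc h π g)) ⟩
        (ρ ⊗ g ⊝ ρ′ ⊗ g) ⊝ h ⊗ (π ⊗ g)     ≈⟨ +-congˡ (-‿cong (trans (sym e) ([x-z]-[x-y]≈y-z x _ _))) ⟩
        (ρ ⊗ g ⊝ ρ′ ⊗ g) ⊝ (ρ ⊗ g ⊝ ρ′ ⊗ g) ≈⟨ -‿inverseʳ _ ⟩
        0#                                  ∎

  -- Each of the `k + 1` multiplications by `π` shrinks the ideal by a factor `q`. The hypothesis
  -- concerns one power less than the conclusion, so `k = r` can be used to show that `π^ r`
  -- vanishes.
  q^k*multiples≤N : ∀ k → ¬ (π^ k ≈ 0#) → q ^ suc k * multiples (π^ suc k) ≤ N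
  q^k*multiples≤N k π^k≉0 = begin
    q ^ suc k * multiples (π^ suc k)          ≡⟨ ≡.cong (_* multiples (π^ suc k)) (ℕ.*-comm q (q ^ k)) ⟩
    q ^ k * q * multiples (π^ suc k)          ≡⟨ ℕ.*-assoc (q ^ k) q _ ⟩
    q ^ k * (q * multiples (π^ suc k))        ≤⟨ ℕ.*-monoʳ-≤ (q ^ k) (q*multiples-π≤multiples π^k≉0) ⟩
    q ^ k * multiples (π^ k)                  ≤⟨ previous k π^k≉0 ⟩
    N                                         ∎
    where
    open ℕ.≤-Reasoning
    previous : ∀ k → ¬ (π^ k ≈ 0#) → q ^ k * multiples (π^ k) ≤ N
    previous zero    _     = ℕ.≤-trans (ℕ.≤-reflexive (ℕ.*-identityˡ _)) (sum-elems-≤N (1# ∣?_))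
    previous (suc k) π^≉0 = q^k*multiples≤N k (λ e → π^≉0 (trans (*-congˡ e) (zeroʳ π)))

  1≤multiples : ∀ g → 1 ≤ multiples g
  1≤multiples g with find (elems-complete 0#)
  ... | z , z∈ , 0≈z = ℕ.≤-trans
    (ℕ.≤-reflexive (≡.sym (⟦⟧-true (∣-respʳ 0≈z (has-0 (principal g))) (g ∣? z))))
    (term≤sumOver (λ x → ⟦ g ∣? x ⟧) z∈)

  -- Otherwise the multiples of the next power, among them 0, would force `q ^ suc r ≤ q ^ r`.
  π^r≈0 : 2 ≤ q → π^ r ≈ 0#
  π^r≈0 2≤q = decidable-stable (π^ r ≟ 0#) λ π^r≉0 → ℕ.<⇒≱ (ℕ.≤-refl {suc N}) (begin
    suc N                              ≤⟨ ℕ.+-monoˡ-≤ N (ℕ.m^n>0 q r) ⟩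
    N + N                              ≡⟨ ≡.cong (N +_) (≡.sym (ℕ.+-identityʳ N)) ⟩
    2 * N                              ≤⟨ ℕ.*-monoˡ-≤ N 2≤q ⟩
    q ^ suc r                          ≡⟨ ≡.sym (ℕ.*-identityʳ _) ⟩
    q ^ suc r * 1                      ≤⟨ ℕ.*-monoʳ-≤ (q ^ suc r) (1≤multiples (π^ suc r)) ⟩
    q ^ suc r * multiples (π^ suc r)   ≤⟨ q^k*multiples≤N r π^r≉0 ⟩
    N                                  ∎)
    where
    open ℕ.≤-Reasoning
    instance
      q≢0 = >-nonZero (ℕ.<-trans (s≤s z≤n) 2≤q)

  private
    -- Divide by `π` until the cofactor is a unit or `j` factors have been removed. With `j = r` the
    -- second outcome means that `b` is zero.
    factor : ∀ j b → Σ ℕ λ k → k ≤ j × Σ Carrier λ u → b ≈ u ⊗ π^ k × (Unit u ⊎ k ≡ j)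
    factor zero    b = 0 , z≤n , b , sym (*-identityʳ b) , inj₂ ≡.refl
    factor (suc j) b with factor j b
    ... | k , k≤j , u , e , inj₁ unit = k , ℕ.m≤n⇒m≤1+n k≤j , u , e , inj₁ unit
    ... | k , k≤j , u , e , inj₂ ≡.refl with u ∣? 1#
    ...   | yes unit = k , ℕ.m≤n⇒m≤1+n k≤j , u , e , inj₁ unit
    ...   | no ¬unit with π∣nonunit ¬unit
    ...     | h , e′ = suc k , ℕ.≤-refl , h , trans e (trans (*-congʳ e′) (*-assoc h π (π^ k))) , inj₂ ≡.refl

  -- Every `b` is a multiple of some `π^ k` with `k ≤ r` whose annihilator is at least as large.
  -- Grouping by `k` gives `r + 1` groups, each contributing at most `N` by
  -- `multiples*annihilators≤N`.
  sum-annihilators : 2 ≤ q → (∑[ b ∈ elems ] annihilators b) ≤ suc r * N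
  sum-annihilators 2≤q = begin
    (∑[ b ∈ elems ] annihilators b)
      ≤⟨ sumOver-mono elems bound ⟩
    (∑[ b ∈ elems ] (∑[ k ∈ upTo (suc r) ] (⟦ π^ k ∣? b ⟧ * annihilators (π^ k))))
      ≡⟨ sumOver-swap elems (upTo (suc r)) _ ⟩
    (∑[ k ∈ upTo (suc r) ] (∑[ b ∈ elems ] (⟦ π^ k ∣? b ⟧ * annihilators (π^ k))))
      ≡⟨ sumOver-cong (upTo (suc r)) (λ k → sumOver-*ʳ elems (annihilators (π^ k)) _) ⟩
    (∑[ k ∈ upTo (suc r) ] (multiples (π^ k) * annihilators (π^ k)))
      ≤⟨ sumOver-mono (upTo (suc r)) (λ k → multiples*annihilators≤N (π^ k)) ⟩
    (∑[ _ ∈ upTo (suc r) ] N)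
      ≡⟨ sumOver-const (upTo (suc r)) N ⟩
    length (upTo (suc r)) * N
      ≡⟨ ≡.cong (_* N) (length-upTo (suc r)) ⟩
    suc r * N ∎
    where
    open ℕ.≤-Reasoning
    bound : ∀ b → annihilators b ≤ (∑[ k ∈ upTo (suc r) ] (⟦ π^ k ∣? b ⟧ * annihilators (π^ k)))
    bound b with factor r b
    ... | k , k≤r , u , e , unit-or-top = ℕ.≤-trans (begin
      annihilators b                            ≤⟨ sumOver-mono elems (λ c → ⟦⟧-mono (kills c unit-or-top) (b ⊗ c ≟ 0#) (π^ k ⊗ c ≟ 0#)) ⟩
      annihilators (π^ k)                       ≡⟨ ℕ.*-identityˡ _ ⟨
      1 * annihilators (π^ k)                   ≡⟨ ≡.cong (_* annihilators (π^ k)) (⟦⟧-true (u , e) (π^ k ∣? b)) ⟨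
      ⟦ π^ k ∣? b ⟧ * annihilators (π^ k)       ∎)
      (term≤sumOver (λ k → ⟦ π^ k ∣? b ⟧ * annihilators (π^ k)) (∈.∈-upTo⁺ (s≤s k≤r)))
      where
      kills : ∀ c → Unit u ⊎ k ≡ r → b ⊗ c ≈ 0# → π^ k ⊗ c ≈ 0#
      kills c (inj₁ unit)   bc≈0 = unit-cancel unit (trans (sym (*-assoc u (π^ k) c)) (trans (*-congʳ (sym e)) bc≈0))
      kills c (inj₂ ≡.refl) bc≈0 = trans (*-congʳ (π^r≈0 2≤q)) (zeroˡ c)

  -- Vectors and zeros of linear forms

  vecs : ∀ n → List (Vec R n)
  vecs zero    = []ᵛ ∷ []
  vecs (suc n) = concatMap (λ c → map (c ∷ᵛ_) (vecs n)) elems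

  sumOver-vecs : ∀ n (f : Vec R (suc n) → ℕ) →
                 sumOver (vecs (suc n)) f ≡ (∑[ c ∈ elems ] (∑[ v ∈ vecs n ] f (c ∷ᵛ v)))
  sumOver-vecs n f = ≡.trans (sumOver-concatMap _ elems f)
    (sumOver-cong elems (λ c → sumOver-map (c ∷ᵛ_) (vecs n) f))

  sumOver-vecs-× : ∀ n {P : Vec R (suc n) → Set} {Q : Carrier → Set} {S : Vec R n → Set}
    (P? : ∀ v → Dec (P v)) (Q? : ∀ c → Dec (Q c)) (S? : ∀ v → Dec (S v)) →
    (∀ {c v} → P (c ∷ᵛ v) → Q c × S v) → (∀ {c v} → Q c → S v → P (c ∷ᵛ v)) →
    (∑[ v ∈ vecs (suc n) ] ⟦ P? v ⟧) ≡ (∑[ c ∈ elems ] ⟦ Q? c ⟧) * (∑[ v ∈ vecs n ] ⟦ S? v ⟧)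
  sumOver-vecs-× n P? Q? S? split join = begin
    (∑[ v ∈ vecs (suc n) ] ⟦ P? v ⟧)                          ≡⟨ sumOver-vecs n _ ⟩
    (∑[ c ∈ elems ] (∑[ v ∈ vecs n ] ⟦ P? (c ∷ᵛ v) ⟧))        ≡⟨ sumOver-cong elems (λ c → sumOver-cong (vecs n) (λ v → ⟦⟧-× split join (P? (c ∷ᵛ v)) (Q? c) (S? v))) ⟩
    (∑[ c ∈ elems ] (∑[ v ∈ vecs n ] (⟦ Q? c ⟧ * ⟦ S? v ⟧)))  ≡⟨ sumOver-cong elems (λ c → sumOver-*ˡ (vecs n) ⟦ Q? c ⟧ _) ⟩
    (∑[ c ∈ elems ] (⟦ Q? c ⟧ * (∑[ v ∈ vecs n ] ⟦ S? v ⟧)))  ≡⟨ sumOver-*ʳ elems _ _ ⟩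
    (∑[ c ∈ elems ] ⟦ Q? c ⟧) * (∑[ v ∈ vecs n ] ⟦ S? v ⟧)    ∎
    where open ≡.≡-Reasoning

  vecs-enumerate : ∀ n → Vct.Enumerates n (vecs n)
  vecs-enumerate zero    t = ≡.trans (ℕ.+-identityʳ _) (⟦⟧-true (λ ()) (Vct.≈._≟_ 0 []ᵛ t))
  vecs-enumerate (suc n) t = ≡.trans
    (sumOver-vecs-× n (λ v → Vct.≈._≟_ (suc n) v t) (_≟ t zero) (λ v → Vct.≈._≟_ n v (tail t))
      (λ e → e zero , λ i → e (suc i)) (λ { e e′ zero → e ; e e′ (suc i) → e′ i }))
    (≡.cong₂ _*_ (elems-enumerate (t zero)) (vecs-enumerate n (tail t)))

  length-vecs : ∀ n → length (vecs n) ≡ N ^ n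
  length-vecs n = ≡.trans (≡.sym (sumOver-1 (vecs n))) (total n)
    where
    total : ∀ n → (∑[ _ ∈ vecs n ] 1) ≡ N ^ n
    total zero    = ≡.refl
    total (suc n) = ≡.trans (sumOver-vecs n _) (≡.trans (sumOver-cong elems (λ _ → total n)) (sum-elems-const (N ^ n)))

  Annihilates : Carrier → Vec R n → Set
  Annihilates b w = ∀ i → b ⊗ w i ≈ 0#

  annihilates? : ∀ b (w : Vec R n) → Dec (Annihilates b w)
  annihilates? b w = Fin.all? (λ i → b ⊗ w i ≟ 0#)

  annihilated-vecs : ∀ n b → (∑[ w ∈ vecs n ] ⟦ annihilates? b w ⟧) ≡ annihilators b ^ n
  annihilated-vecs zero    b = ≡.trans (ℕ.+-identityʳ _) (⟦⟧-true (λ ()) (annihilates? b []ᵛ))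
  annihilated-vecs (suc n) b = ≡.trans
    (sumOver-vecs-× n (annihilates? b) (λ c → b ⊗ c ≟ 0#) (annihilates? b)
      (λ e → e zero , λ i → e (suc i)) (λ { e e′ zero → e ; e e′ (suc i) → e′ i }))
    (≡.cong (annihilators b *_) (annihilated-vecs n b))

  ⟦≟0⟧-cong : ∀ {x y} → x ≈ y → ⟦ x ≟ 0# ⟧ ≡ ⟦ y ≟ 0# ⟧
  ⟦≟0⟧-cong {x} {y} x≈y = ⟦⟧-cong (trans (sym x≈y)) (trans x≈y) (x ≟ 0#) (y ≟ 0#)

  -- Shifting `b` by `a ⊗ h` removes `a` from the equation, which leaves `a` free.
  absorb-multiple : ∀ t g h → (∑[ a ∈ elems ] (∑[ b ∈ elems ] ⟦ (t ⊕ a ⊗ (h ⊗ g)) ⊕ b ⊗ g ≟ 0# ⟧)) ≡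
                    N * (∑[ b ∈ elems ] ⟦ t ⊕ b ⊗ g ≟ 0# ⟧)
  absorb-multiple t g h = ≡.trans
    (sumOver-cong elems (λ a → ≡.trans
      (sumOver-cong elems (λ b → ⟦≟0⟧-cong
        (solve 5 (λ t a h g b → (t :+ a :* (h :* g)) :+ b :* g := t :+ (a :* h :+ b) :* g) refl t a h g b)))
      (sum-shift (λ e → ⟦≟0⟧-cong (+-congˡ (*-congʳ e))) (a ⊗ h))))
    (sum-elems-const _)

  -- One coefficient g divides all the others (for n = 0 take g = 0), and a change of variables
  -- reduces the form to b ↦ b g.
  linear-form : ∀ (w : Vec R n) → Σ Carrier λ g → (∀ i → g ∣ w i) × (∀ t →
    N * (∑[ a ∈ vecs n ] ⟦ t ⊕ sum (λ i → a i ⊗ w i) ≟ 0# ⟧) ≡ N ^ n * (∑[ b ∈ elems ] ⟦ t ⊕ b ⊗ g ≟ 0# ⟧))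
  linear-form {zero} w = 0# , (λ ()) , λ t → begin
    N * (⟦ t ⊕ sum _ ≟ 0# ⟧ + 0)                   ≡⟨ ≡.cong (N *_) (ℕ.+-identityʳ _) ⟩
    N * ⟦ t ⊕ sum _ ≟ 0# ⟧                         ≡⟨ sum-elems-const _ ⟨
    (∑[ b ∈ elems ] ⟦ t ⊕ sum _ ≟ 0# ⟧)            ≡⟨ sumOver-cong elems (λ b → ⟦≟0⟧-cong (+-congˡ (trans (sum-empty _) (sym (zeroʳ b))))) ⟩
    (∑[ b ∈ elems ] ⟦ t ⊕ b ⊗ 0# ≟ 0# ⟧)           ≡⟨ ℕ.*-identityˡ _ ⟨
    1 * (∑[ b ∈ elems ] ⟦ t ⊕ b ⊗ 0# ≟ 0# ⟧)       ∎
    where open ≡.≡-Reasoning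
  linear-form {suc n} w with linear-form (tail w)
  ... | g , g∣w , count = combine (∣-total g (w zero))
    where
    open ≡.≡-Reasoning
    both : ∀ t → N * (∑[ a ∈ vecs (suc n) ] ⟦ t ⊕ sum (λ i → a i ⊗ w i) ≟ 0# ⟧) ≡
           N ^ n * (∑[ a ∈ elems ] (∑[ b ∈ elems ] ⟦ (t ⊕ a ⊗ w zero) ⊕ b ⊗ g ≟ 0# ⟧))
    both t = begin
      N * (∑[ a ∈ vecs (suc n) ] ⟦ t ⊕ sum (λ i → a i ⊗ w i) ≟ 0# ⟧)
        ≡⟨ ≡.cong (N *_) (sumOver-vecs n _) ⟩
      N * (∑[ c ∈ elems ] (∑[ a ∈ vecs n ] ⟦ t ⊕ sum (λ i → (c ∷ᵛ a) i ⊗ w i) ≟ 0# ⟧))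
        ≡⟨ ≡.cong (N *_) (sumOver-cong elems (λ c → sumOver-cong (vecs n) (λ a →
             ⟦≟0⟧-cong (trans (+-congˡ (sum-suc _)) (sym (+-assoc t _ _)))))) ⟩
      N * (∑[ c ∈ elems ] (∑[ a ∈ vecs n ] ⟦ (t ⊕ c ⊗ w zero) ⊕ sum (λ i → a i ⊗ tail w i) ≟ 0# ⟧))
        ≡⟨ sumOver-*ˡ elems N _ ⟨
      (∑[ c ∈ elems ] (N * (∑[ a ∈ vecs n ] ⟦ (t ⊕ c ⊗ w zero) ⊕ sum (λ i → a i ⊗ tail w i) ≟ 0# ⟧)))
        ≡⟨ sumOver-cong elems (λ c → count (t ⊕ c ⊗ w zero)) ⟩
      (∑[ c ∈ elems ] (N ^ n * (∑[ b ∈ elems ] ⟦ (t ⊕ c ⊗ w zero) ⊕ b ⊗ g ≟ 0# ⟧)))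
        ≡⟨ sumOver-*ˡ elems (N ^ n) _ ⟩
      N ^ n * (∑[ c ∈ elems ] (∑[ b ∈ elems ] ⟦ (t ⊕ c ⊗ w zero) ⊕ b ⊗ g ≟ 0# ⟧)) ∎
    regroup : ∀ x → N ^ n * (N * x) ≡ N ^ suc n * x
    regroup x = ≡.trans (≡.sym (ℕ.*-assoc (N ^ n) N x)) (≡.cong (_* x) (ℕ.*-comm (N ^ n) N))
    combine : g ∣ w zero ⊎ w zero ∣ g → Σ Carrier λ g′ → (∀ i → g′ ∣ w i) × (∀ t →
      N * (∑[ a ∈ vecs (suc n) ] ⟦ t ⊕ sum (λ i → a i ⊗ w i) ≟ 0# ⟧) ≡ N ^ suc n * (∑[ b ∈ elems ] ⟦ t ⊕ b ⊗ g′ ≟ 0# ⟧))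
    combine (inj₁ (h , e)) = g , (λ { zero → h , e ; (suc i) → g∣w i }) , λ t →
      ≡.trans (both t) (≡.trans (≡.cong (N ^ n *_) (≡.trans
        (sumOver-cong elems (λ a → sumOver-cong elems (λ b → ⟦≟0⟧-cong (+-congʳ (+-congˡ (*-congˡ e))))))
        (absorb-multiple t g h))) (regroup _))
    -- Now the new coefficient divides the old `g`, so the two variables exchange roles and it is
    -- `b` that gets absorbed.
    combine (inj₂ (h , e)) = w zero , (λ { zero → ∣-refl ; (suc i) → ∣-trans (h , e) (g∣w i) }) , λ t →
      ≡.trans (both t) (≡.trans (≡.cong (N ^ n *_) (≡.trans
        (≡.trans (sumOver-swap elems elems _)
          (sumOver-cong elems (λ b → sumOver-cong elems (λ a → ⟦≟0⟧-cong (trans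
            (+-congˡ (*-congˡ e))
            (solve 3 (λ t x y → (t :+ x) :+ y := (t :+ y) :+ x) refl t (a ⊗ w zero) (b ⊗ (h ⊗ w zero))))))))
        (absorb-multiple t (w zero) h))) (regroup _))

  -- With `g` dividing all later coordinates of `w`, the equation becomes `t ⊕ b ⊗ g ≈ 0#`. If it
  -- has a solution, `g` also divides `w zero`; the solutions form a coset of the annihilator of
  -- `g`, and that annihilator kills all of `w`.
  directions-killing : ∀ (w : Vec R (suc n)) →
    N * (∑[ a ∈ vecs n ] ⟦ lin a w ≟ 0# ⟧) ≤ N ^ n * (∑[ b ∈ elems ] ⟦ annihilates? b w ⟧)
  directions-killing {n} w with linear-form (tail w)
  ... | g , g∣w , count = ℕ.≤-trans (ℕ.≤-reflexive (count (w zero))) (ℕ.*-monoʳ-≤ (N ^ n) (solutions (g ∣? ⊖ w zero)))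
    where
    open ≈-Reasoning
    t = w zero
    moved : ∀ b → t ⊕ b ⊗ g ≈ 0# → b ⊗ g ≈ ⊖ t
    moved b e = +-inverseʳ-unique t (b ⊗ g) e
    solutions : Dec (g ∣ ⊖ t) → (∑[ b ∈ elems ] ⟦ t ⊕ b ⊗ g ≟ 0# ⟧) ≤ (∑[ b ∈ elems ] ⟦ annihilates? b w ⟧)
    solutions (no ∤) = sumOver-mono elems (λ b → ⟦⟧-mono
      (λ e → ⊥-elim (∤ (b , sym (moved b e)))) (t ⊕ b ⊗ g ≟ 0#) (annihilates? b w))
    solutions (yes (h , e)) = ℕ.≤-trans (ℕ.≤-trans
      (sumOver-mono elems (λ b → ⟦⟧-mono (moved b) (t ⊕ b ⊗ g ≟ 0#) (b ⊗ g ≟ ⊖ t)))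
      (ℕ.≤-reflexive (fibre-size (h , e))))
      (sumOver-mono elems (λ b → ⟦⟧-mono (λ gb≈0 → λ
        { zero → killed b gb≈0 (⊖ h) (begin
            t            ≈⟨ -‿involutive t ⟨
            ⊖ ⊖ t        ≈⟨ -‿cong e ⟩
            ⊖ (h ⊗ g)    ≈⟨ -‿distribˡ-* h g ⟩
            ⊖ h ⊗ g      ∎)
        ; (suc i) → killed b gb≈0 (proj₁ (g∣w i)) (proj₂ (g∣w i)) }) (g ⊗ b ≟ 0#) (annihilates? b w)))
      where
      killed : ∀ b → g ⊗ b ≈ 0# → ∀ k {x} → x ≈ k ⊗ g → b ⊗ x ≈ 0#
      killed b gb≈0 k {x} x≈kg = begin
        b ⊗ x         ≈⟨ *-congˡ x≈kg ⟩
        b ⊗ (k ⊗ g)   ≈⟨ solve 3 (λ b k g → b :* (k :* g) := k :* (g :* b)) refl b k g ⟩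
        k ⊗ (g ⊗ b)   ≈⟨ *-congˡ gb≈0 ⟩
        k ⊗ 0#        ≈⟨ zeroʳ k ⟩
        0#            ∎

  -- Collisions of linear forms on a point set

  DistinctVecs : List (Vec R n) → Set
  DistinctVecs = AllPairs (λ x y → ¬ (_≈ᵥ_ R x y))

  collisions : List (Vec R (suc n)) → Vec R n → ℕ
  collisions E a = ∑[ x ∈ E ] (∑[ y ∈ E ] ⟦ lin a x ≟ lin a y ⟧)

  torsionPairs : List (Vec R n) → Carrier → ℕ
  torsionPairs E b = ∑[ x ∈ E ] (∑[ y ∈ E ] ⟦ annihilates? b (_-ᵥ_ R x y) ⟧)

  -- Sum `directions-killing` over all differences `x - y`. On the right, `b = 0` gives the main
  -- term and the other `b` the error.
  sum-collisions : (E : List (Vec R (suc n))) →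
    N * (∑[ a ∈ vecs n ] collisions E a) ≤ N ^ n * (∑[ b ∈ elems ] torsionPairs E b)
  sum-collisions {n} E = begin
    N * (∑[ a ∈ vecs n ] collisions E a)
      ≡⟨ ≡.cong (N *_) (rotate (vecs n) (λ a x y → ⟦ lin a x ≟ lin a y ⟧)) ⟩
    N * (∑[ x ∈ E ] (∑[ y ∈ E ] (∑[ a ∈ vecs n ] ⟦ lin a x ≟ lin a y ⟧)))
      ≡⟨ sumOver-*ˡ₂ N _ ⟨
    (∑[ x ∈ E ] (∑[ y ∈ E ] (N * (∑[ a ∈ vecs n ] ⟦ lin a x ≟ lin a y ⟧))))
      ≤⟨ sumOver-mono E (λ x → sumOver-mono E (λ y → ℕ.≤-trans
           (ℕ.*-monoʳ-≤ N (sumOver-mono (vecs n) (λ a → ⟦⟧-mono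
             (λ e → trans (lin-⊝ a x y) (x≈y⇒x∙y⁻¹≈ε e)) (lin a x ≟ lin a y) (lin a (_-ᵥ_ R x y) ≟ 0#))))
           (directions-killing (_-ᵥ_ R x y)))) ⟩
    (∑[ x ∈ E ] (∑[ y ∈ E ] (N ^ n * (∑[ b ∈ elems ] ⟦ annihilates? b (_-ᵥ_ R x y) ⟧))))
      ≡⟨ sumOver-*ˡ₂ (N ^ n) _ ⟩
    N ^ n * (∑[ x ∈ E ] (∑[ y ∈ E ] (∑[ b ∈ elems ] ⟦ annihilates? b (_-ᵥ_ R x y) ⟧)))
      ≡⟨ ≡.cong (N ^ n *_) (rotate elems (λ b x y → ⟦ annihilates? b (_-ᵥ_ R x y) ⟧)) ⟨
    N ^ n * (∑[ b ∈ elems ] torsionPairs E b) ∎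
    where
    open ℕ.≤-Reasoning
    rotate : {A : Set} (as : List A) (f : A → Vec R (suc n) → Vec R (suc n) → ℕ) →
             (∑[ a ∈ as ] (∑[ x ∈ E ] (∑[ y ∈ E ] f a x y))) ≡ (∑[ x ∈ E ] (∑[ y ∈ E ] (∑[ a ∈ as ] f a x y)))
    rotate as f = ≡.trans (sumOver-swap as E _) (sumOver-cong E (λ x → sumOver-swap as E _))
    sumOver-*ˡ₂ : ∀ k (f : Vec R (suc n) → Vec R (suc n) → ℕ) →
                  (∑[ x ∈ E ] (∑[ y ∈ E ] (k * f x y))) ≡ k * (∑[ x ∈ E ] (∑[ y ∈ E ] f x y))
    sumOver-*ˡ₂ k f = ≡.trans (sumOver-cong E (λ x → sumOver-*ˡ E k (f x))) (sumOver-*ˡ E k _)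

  -- For fixed `x` the reflection sending `y` to `x - y` is its own inverse, so it embeds `E` and
  -- the partners of `x` land among the vectors killed by `b`.
  torsionPairs-≤ : ∀ {E : List (Vec R n)} → DistinctVecs E → ∀ b →
                   torsionPairs E b ≤ length E * annihilators b ^ n
  torsionPairs-≤ {n} {E} dis b = begin
    torsionPairs E b                              ≤⟨ sumOver-mono E around ⟩
    (∑[ _ ∈ E ] (annihilators b ^ n))             ≡⟨ sumOver-const E _ ⟩
    length E * annihilators b ^ n                 ∎
    where
    open ℕ.≤-Reasoning
    annihilates-cong : Vct.Respects n (λ v → ⟦ annihilates? b v ⟧)
    annihilates-cong {u} {v} e = ⟦⟧-cong (λ k i → trans (*-congˡ (sym (e i))) (k i))
      (λ k i → trans (*-congˡ (e i)) (k i)) (annihilates? b u) (annihilates? b v)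
    reflected : ∀ (x : Vec R n) {u v} → _≈ᵥ_ R (_-ᵥ_ R x u) v → _≈ᵥ_ R (_-ᵥ_ R x v) u
    reflected x {u} e i = trans (+-congˡ (-‿cong (sym (e i)))) (x-[x-y]≈y (x i) (u i))
    around : ∀ x → (∑[ y ∈ E ] ⟦ annihilates? b (_-ᵥ_ R x y) ⟧) ≤ annihilators b ^ n
    around x = begin
      (∑[ y ∈ E ] ⟦ annihilates? b (_-ᵥ_ R x y) ⟧)
        ≤⟨ Vct.sumOver-⊆ n {vecs n} (vecs-enumerate n) dis
             (λ e → annihilates-cong (λ i → +-congˡ (-‿cong (e i)))) ⟩
      (∑[ v ∈ vecs n ] ⟦ annihilates? b (_-ᵥ_ R x v) ⟧)
        ≡⟨ Vct.sumOver-reindex n {vecs n} (vecs-enumerate n) annihilates-cong (_-ᵥ_ R x) (_-ᵥ_ R x)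
             (reflected x) (reflected x) ⟩
      (∑[ v ∈ vecs n ] ⟦ annihilates? b v ⟧)
        ≡⟨ annihilated-vecs n b ⟩
      annihilators b ^ n ∎

  -- The term `b = 0` counts all pairs. For other `b`, one factor of `annihilators b ^ (2 + e)` is
  -- at most `N / q`, `e` factors are at most `N`, and the last is kept for `sum-annihilators`.
  sum-torsionPairs : 2 ≤ q → ∀ e {E : List (Vec R (2 + e))} → DistinctVecs E →
    q * (∑[ b ∈ elems ] torsionPairs E b) ≤ q * (length E * length E) + length E * (suc r * N ^ (2 + e))
  sum-torsionPairs 2≤q e {E} dis = begin
    q * (∑[ b ∈ elems ] torsionPairs E b)
      ≡⟨ sumOver-*ˡ elems q _ ⟨
    (∑[ b ∈ elems ] (q * torsionPairs E b))
      ≤⟨ sumOver-mono elems (λ b → bound b (b ≟ 0#)) ⟩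
    (∑[ b ∈ elems ] (⟦ b ≟ 0# ⟧ * (q * (L * L)) + L * N ^ (1 + e) * annihilators b))
      ≡⟨ sumOver-+ elems _ _ ⟩
    (∑[ b ∈ elems ] (⟦ b ≟ 0# ⟧ * (q * (L * L)))) + (∑[ b ∈ elems ] (L * N ^ (1 + e) * annihilators b))
      ≡⟨ ≡.cong₂ _+_ (Elt.sumOver-δ {elems} elems-enumerate (λ _ → ≡.refl) 0#) (sumOver-*ˡ elems (L * N ^ (1 + e)) _) ⟩
    q * (L * L) + L * N ^ (1 + e) * (∑[ b ∈ elems ] annihilators b)
      ≤⟨ ℕ.+-monoʳ-≤ (q * (L * L)) (ℕ.*-monoʳ-≤ (L * N ^ (1 + e)) (sum-annihilators 2≤q)) ⟩
    q * (L * L) + L * N ^ (1 + e) * (suc r * N)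
      ≡⟨ ≡.cong (q * (L * L) +_) (natSolve 4 (λ L M r N → L :*ₙ M :*ₙ (r :*ₙ N) :=ₙ L :*ₙ (r :*ₙ (N :*ₙ M))) ≡.refl L (N ^ (1 + e)) (suc r) N) ⟩
    q * (L * L) + L * (suc r * N ^ (2 + e)) ∎
    where
    open ℕ.≤-Reasoning
    open +-*-Solver using () renaming (solve to natSolve; _:*_ to _:*ₙ_; _:=_ to _:=ₙ_)
    L = length E
    bound : ∀ b (b? : Dec (b ≈ 0#)) → q * torsionPairs E b ≤ ⟦ b? ⟧ * (q * (L * L)) + L * N ^ (1 + e) * annihilators b
    bound b (yes _) = ℕ.≤-trans
      (ℕ.*-monoʳ-≤ q (ℕ.≤-trans
        (sumOver-mono E (λ x → ℕ.≤-trans (sumOver-mono E (λ y → ⟦⟧≤1 (annihilates? b (_-ᵥ_ R x y)))) (ℕ.≤-reflexive (sumOver-1 E))))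
        (ℕ.≤-reflexive (sumOver-const E L))))
      (ℕ.≤-trans (ℕ.≤-reflexive (≡.sym (ℕ.*-identityˡ (q * (L * L))))) (ℕ.m≤m+n _ _))
    bound b (no b≉0) = begin
      q * torsionPairs E b           ≤⟨ ℕ.*-monoʳ-≤ q (torsionPairs-≤ dis b) ⟩
      q * (L * (A * (A * A ^ e)))    ≡⟨ natSolve 4 (λ q L A P → q :*ₙ (L :*ₙ (A :*ₙ (A :*ₙ P))) :=ₙ L :*ₙ (q :*ₙ A :*ₙ P) :*ₙ A) ≡.refl q L A (A ^ e) ⟩
      L * (q * A * A ^ e) * A        ≤⟨ ℕ.*-monoˡ-≤ A (ℕ.*-monoʳ-≤ L (ℕ.*-mono-≤ (q*annihilators≤N b≉0)
                                          (ℕ.^-monoˡ-≤ e (sum-elems-≤N (λ x → b ⊗ x ≟ 0#))))) ⟩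
      L * (N * N ^ e) * A            ∎
      where A = annihilators b

  -- For positive `m` this makes the collisions at most `(1 + 1/m)` times `|E|² / N`: the density
  -- hypothesis bounds `m` times the error term by `q * (L * L)`, and some direction does no worse
  -- than the average.
  good-direction : 2 ≤ q → ∀ m e {E : List (Vec R (2 + e))} → DistinctVecs E →
    suc m * (suc r * N ^ (2 + e)) ≤ q * length E →
    Σ (Vec R (1 + e)) λ a → m * (N * collisions E a) ≤ suc m * (length E * length E)
  good-direction 2≤q m e {E} dis large = proj₁ found , ℕ.*-cancelˡ-≤ q (proj₂ found)
    where
    open ℕ.≤-Reasoning
    open +-*-Solver using () renaming (solve to natSolve; _:*_ to _:*ₙ_; _:+_ to _:+ₙ_; _:=_ to _:=ₙ_; con to conₙ)
    instance
      q≢0 = >-nonZero (ℕ.<-trans (s≤s z≤n) 2≤q)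
      N≢0 = >-nonZero (ℕ.m^n>0 q r)
    L = length E
    X = suc r * N ^ (2 + e)
    T = ∑[ b ∈ elems ] torsionPairs E b
    W = ∑[ a ∈ vecs (1 + e) ] collisions E a
    average : (∑[ a ∈ vecs (1 + e) ] (q * (m * (N * collisions E a)))) ≤ length (vecs (1 + e)) * (q * (suc m * (L * L)))
    average = begin
      (∑[ a ∈ vecs (1 + e) ] (q * (m * (N * collisions E a))))
        ≡⟨ sumOver-cong (vecs (1 + e)) (λ a → natSolve 4 (λ q m N c → q :*ₙ (m :*ₙ (N :*ₙ c)) :=ₙ q :*ₙ m :*ₙ N :*ₙ c) ≡.refl q m N _) ⟩
      (∑[ a ∈ vecs (1 + e) ] (q * m * N * collisions E a))
        ≡⟨ sumOver-*ˡ (vecs (1 + e)) (q * m * N) _ ⟩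
      q * m * N * W
        ≡⟨ ℕ.*-assoc (q * m) N W ⟩
      q * m * (N * W)
        ≤⟨ ℕ.*-monoʳ-≤ (q * m) (sum-collisions E) ⟩
      q * m * (N ^ (1 + e) * T)
        ≡⟨ natSolve 4 (λ q m M T → q :*ₙ m :*ₙ (M :*ₙ T) :=ₙ M :*ₙ (m :*ₙ (q :*ₙ T))) ≡.refl q m (N ^ (1 + e)) T ⟩
      N ^ (1 + e) * (m * (q * T))
        ≤⟨ ℕ.*-monoʳ-≤ (N ^ (1 + e)) (ℕ.*-monoʳ-≤ m (sum-torsionPairs 2≤q e dis)) ⟩
      N ^ (1 + e) * (m * (q * (L * L) + L * X))
        ≡⟨ ≡.cong (N ^ (1 + e) *_) (natSolve 4 (λ m q L X → m :*ₙ (q :*ₙ (L :*ₙ L) :+ₙ L :*ₙ X) :=ₙ m :*ₙ (q :*ₙ (L :*ₙ L)) :+ₙ L :*ₙ (m :*ₙ X)) ≡.refl m q L X) ⟩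
      N ^ (1 + e) * (m * (q * (L * L)) + L * (m * X))
        ≤⟨ ℕ.*-monoʳ-≤ (N ^ (1 + e)) (ℕ.+-monoʳ-≤ (m * (q * (L * L))) (ℕ.*-monoʳ-≤ L (ℕ.≤-trans (ℕ.*-monoˡ-≤ X (ℕ.n≤1+n m)) large))) ⟩
      N ^ (1 + e) * (m * (q * (L * L)) + L * (q * L))
        ≡⟨ ≡.cong₂ _*_ (≡.sym (length-vecs (1 + e))) (natSolve 3 (λ m q L → m :*ₙ (q :*ₙ (L :*ₙ L)) :+ₙ L :*ₙ (q :*ₙ L) :=ₙ q :*ₙ ((conₙ 1 :+ₙ m) :*ₙ (L :*ₙ L))) ≡.refl m q L) ⟩
      length (vecs (1 + e)) * (q * (suc m * (L * L))) ∎
    found = below-average (vecs (1 + e)) (λ a → q * (m * (N * collisions E a))) (q * (suc m * (L * L)))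
      (ℕ.<-≤-trans (ℕ.m^n>0 N (1 + e)) (ℕ.≤-reflexive (≡.sym (length-vecs (1 + e))))) average

  attained? : ∀ (E : List (Vec R (suc n))) a c → Dec (Any (λ x → lin a x ≈ c) E)
  attained? E a c = any? (λ x → lin a x ≟ c) E

  -- Cauchy-Schwarz for the fibre sizes `s c`: they add up to `length E`, and their squares add up
  -- to the number of collisions.
  attained*collisions : ∀ (E : List (Vec R (suc n))) a →
    length E * length E ≤ (∑[ c ∈ elems ] ⟦ attained? E a c ⟧) * collisions E a
  attained*collisions E a = begin
    length E * length E                                  ≡⟨ ≡.cong₂ _*_ total total ⟨
    sumOver elems s * sumOver elems s                    ≤⟨ cauchySchwarz elems s (λ c → ⟦ attained? E a c ⟧) support ⟩
    (∑[ c ∈ elems ] ⟦ attained? E a c ⟧) * (∑[ c ∈ elems ] (s c * s c))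
      ≡⟨ ≡.cong ((∑[ c ∈ elems ] ⟦ attained? E a c ⟧) *_) squares ⟩
    (∑[ c ∈ elems ] ⟦ attained? E a c ⟧) * collisions E a ∎
    where
    open ℕ.≤-Reasoning
    s : Carrier → ℕ
    s c = ∑[ x ∈ E ] ⟦ lin a x ≟ c ⟧
    ⟦≟⟧-sym : ∀ x y → ⟦ x ≟ y ⟧ ≡ ⟦ y ≟ x ⟧
    ⟦≟⟧-sym x y = ⟦⟧-cong sym sym (x ≟ y) (y ≟ x)
    s-cong : Elt.Respects s
    s-cong {c} {c′} e = sumOver-cong E (λ x → ⟦⟧-cong (λ e′ → trans e′ e) (λ e′ → trans e′ (sym e)) (lin a x ≟ c) (lin a x ≟ c′))
    total : sumOver elems s ≡ length E
    total = ≡.trans (sumOver-swap elems E _) (≡.trans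
      (sumOver-cong E (λ x → ≡.trans (sumOver-cong elems (λ c → ⟦≟⟧-sym (lin a x) c)) (elems-enumerate (lin a x))))
      (sumOver-1 E))
    squares : (∑[ c ∈ elems ] (s c * s c)) ≡ collisions E a
    squares = ≡.trans
      (sumOver-cong elems (λ c → ≡.sym (sumOver-*ʳ E (s c) _)))
      (≡.trans (sumOver-swap elems E _)
        (sumOver-cong E (λ x → ≡.trans
          (sumOver-cong elems (λ c → ≡.cong (_* s c) (⟦≟⟧-sym (lin a x) c)))
          (≡.trans (Elt.sumOver-δ {elems} elems-enumerate s-cong (lin a x))
            (sumOver-cong E (λ y → ⟦≟⟧-sym (lin a y) (lin a x)))))))
    support : ∀ c → s c ≡ 0 ⊎ ⟦ attained? E a c ⟧ ≡ 1
    support c with attained? E a c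
    ... | yes _ = inj₂ ≡.refl
    ... | no ¬p = inj₁ (ℕ.n≤0⇒n≡0 (ℕ.≤-trans
      (sumOver-mono-∈ E (λ {x} x∈ → ⟦⟧-mono (λ e → ¬p (lose x∈ e)) (lin a x ≟ c) (no (λ ()))))
      (ℕ.≤-reflexive (≡.trans (sumOver-const E 0) (ℕ.*-zeroʳ (length E))))))

  -- Affine frames with unit determinant in dense sets

  slice : (Vec R (suc n) → Carrier) → Carrier → List (Vec R (suc n)) → List (Vec R n)
  slice f c S = map tail (filter (λ x → f x ≟ c) S)

  slice-distinct : (f : Vec R (suc n) → Carrier) →
    (∀ {x y} → f x ≈ f y → _≈ᵥ_ R (tail x) (tail y) → _≈ᵥ_ R x y) →
    ∀ c {S} → DistinctVecs S → DistinctVecs (slice f c S)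
  slice-distinct {n} f inj c {S} dis = AllPairsP.map⁺
    (separate (AllP.all-filter (λ x → f x ≟ c) S) (AllPairsP.filter⁺ (λ x → f x ≟ c) dis))
    where
    separate : ∀ {xs} → All (λ x → f x ≈ c) xs → DistinctVecs xs →
               AllPairs (λ x y → ¬ (_≈ᵥ_ R (tail x) (tail y))) xs
    separate [] [] = []
    separate (fx ∷ fxs) (x≉ ∷ ds) =
      All.zipWith (λ (fy , x≉y) e → x≉y (inj (trans fx (sym fy)) e)) (fxs , x≉) ∷ separate fxs ds

  -- Pigeonhole over the `N` levels of `f`: density above `1/q` passes to some slice, one dimension
  -- lower.
  large-slice : (f : Vec R (suc n) → Carrier) (S : List (Vec R (suc n))) → N ^ suc n < q * length S →
    Σ Carrier λ c → N ^ n < q * length (slice f c S)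
  large-slice {n} f S large = pigeonhole elems (λ c → q * length (slice f c S)) (N ^ n) (begin-strict
    length elems * N ^ n                           ≡⟨ ≡.cong (_* N ^ n) (proj₁ (proj₂ card)) ⟩
    N ^ suc n                                      <⟨ large ⟩
    q * length S                                   ≡⟨ ≡.cong (q *_) partition ⟨
    q * (∑[ c ∈ elems ] length (slice f c S))      ≡⟨ sumOver-*ˡ elems q _ ⟨
    (∑[ c ∈ elems ] (q * length (slice f c S)))    ∎)
    where
    open ℕ.≤-Reasoning
    partition : (∑[ c ∈ elems ] length (slice f c S)) ≡ length S
    partition = ≡.trans
      (sumOver-cong elems (λ c → ≡.trans (length-map tail (filter (λ x → f x ≟ c) S)) (length-filter (λ x → f x ≟ c) S)))
      (≡.trans (sumOver-swap elems S _) (≡.trans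
        (sumOver-cong S (λ x → ≡.trans (sumOver-cong elems (λ c → ⟦⟧-cong sym sym (f x ≟ c) (c ≟ f x))) (elems-enumerate (f x))))
        (sumOver-1 S)))

  slice-∈ : (f : Vec R (suc n) → Carrier) (c : Carrier) (S : List (Vec R (suc n))) {v : Vec R n} → v ∈ slice f c S →
    Σ (Vec R (suc n)) λ x → x ∈ S × f x ≈ c × v ≡ tail x
  slice-∈ f c S v∈ with ∈.∈-map⁻ tail v∈
  ... | x , x∈ , v≡ with ∈.∈-filter⁻ (λ x → f x ≟ c) x∈
  ...   | x∈S , fx≈c = x , x∈S , fx≈c , v≡

  -- An affine basis: the differences from the origin form a basis of the free module.
  record Frame (S : List (Vec R n)) : Set where
    field
      origin   : Vec R n
      points   : Fin n → Vec R n
      origin∈  : origin ∈ S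
      points∈  : ∀ i → points i ∈ S
      unit     : Unit (det R (λ i j → points j i ⊝ origin i))

  -- One vector short of a frame; a further point, placed first, contributes the remaining factor of
  -- the determinant.
  record SlicedFrame (f : Vec R (suc n) → Carrier) (S : List (Vec R (suc n))) : Set where
    field
      origin   : Vec R (suc n)
      points   : Fin n → Vec R (suc n)
      origin∈  : origin ∈ S
      points∈  : ∀ i → points i ∈ S
      level    : ∀ j → f (points j) ≈ f origin
      unit     : Unit (det R (λ i j → points j (suc i) ⊝ origin (suc i)))

  unit-resp : ∀ {u v} → u ≈ v → Unit u → Unit v
  unit-resp u≈v (w , e) = w , trans e (*-congˡ u≈v)

  unit-* : ∀ {u v} → Unit u → Unit v → Unit (u ⊗ v)
  unit-* {u} {v} (u′ , e) (v′ , e′) = u′ ⊗ v′ , (begin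
    1#                       ≈⟨ *-identityˡ 1# ⟨
    1# ⊗ 1#                  ≈⟨ *-cong e e′ ⟩
    (u′ ⊗ u) ⊗ (v′ ⊗ v)      ≈⟨ solve 4 (λ a b c d → (a :* b) :* (c :* d) := (a :* c) :* (b :* d)) refl u′ u v′ v ⟩
    (u′ ⊗ v′) ⊗ (u ⊗ v)      ∎)
    where open ≈-Reasoning

  lift-frame : ∀ (f : Vec R (suc n) → Carrier) c S → Frame (slice f c S) → SlicedFrame f S
  lift-frame f c S F = record
    { origin = proj₁ o
    ; points = λ j → proj₁ (p j)
    ; origin∈ = proj₁ (proj₂ o)
    ; points∈ = λ j → proj₁ (proj₂ (p j))
    ; level = λ j → trans (proj₁ (proj₂ (proj₂ (p j)))) (sym (proj₁ (proj₂ (proj₂ o))))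
    ; unit = unit-resp (det-cong (λ i j → +-cong
        (reflexive (≡.cong (λ v → v i) (proj₂ (proj₂ (proj₂ (p j))))))
        (-‿cong (reflexive (≡.cong (λ v → v i) (proj₂ (proj₂ (proj₂ o)))))))) (Frame.unit F) }
    where
    o = slice-∈ f c S (Frame.origin∈ F)
    p = λ j → slice-∈ f c S (Frame.points∈ F j)

  -- If all first coordinates were congruent modulo 𝔪, then S would fill at most one q-th of the space.
  unit-step : ∀ {S : List (Vec R (suc n))} → DistinctVecs S → N ^ suc n < q * length S → ∀ t →
    Any (λ x → Unit (x zero ⊝ t)) S
  unit-step {n} {S} dis large t = decidable-stable (any? (λ x → (x zero ⊝ t) ∣? 1#) S) λ none →
    ℕ.<⇒≱ large (begin
      q * length S
        ≡⟨ ≡.cong (q *_) (sumOver-1 S) ⟨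
      q * (∑[ _ ∈ S ] 1)
        ≤⟨ ℕ.*-monoʳ-≤ q (sumOver-mono-∈ S (λ {x} x∈ →
             ℕ.≤-reflexive (≡.sym (⟦⟧-true (λ u → none (lose x∈ u)) (near? x))))) ⟩
      q * (∑[ x ∈ S ] ⟦ near? x ⟧)
        ≤⟨ ℕ.*-monoʳ-≤ q (Vct.sumOver-⊆ (suc n) {vecs (suc n)} (vecs-enumerate (suc n)) dis
             (λ {x} {y} e → near-cong (e zero) (near? x) (near? y))) ⟩
      q * (∑[ x ∈ vecs (suc n) ] ⟦ near? x ⟧)
        ≡⟨ ≡.cong (q *_) (sumOver-vecs-× n near? (λ c → ¬? ((c ⊝ t) ∣? 1#)) (λ _ → yes tt)
             (λ p → p , tt) (λ p _ → p)) ⟩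
      q * ((∑[ c ∈ elems ] ⟦ ¬? ((c ⊝ t) ∣? 1#) ⟧) * (∑[ _ ∈ vecs n ] 1))
        ≡⟨ ≡.cong₂ (λ k l → q * (k * l))
             (sum-translate (λ {x} {y} e → ⟦⟧-cong (λ ¬u u → ¬u (unit-resp (sym e) u)) (λ ¬u u → ¬u (unit-resp e u))
               (¬? (x ∣? 1#)) (¬? (y ∣? 1#))) t)
             (≡.trans (sumOver-1 (vecs n)) (length-vecs n)) ⟩
      q * (nonunits * N ^ n)
        ≡⟨ ℕ.*-assoc q nonunits (N ^ n) ⟨
      q * nonunits * N ^ n
        ≤⟨ ℕ.*-monoˡ-≤ (N ^ n) q*nonunits≤N ⟩
      N ^ suc n ∎)
    where
    open ℕ.≤-Reasoning
    near? : ∀ (x : Vec R (suc n)) → Dec (¬ Unit (x zero ⊝ t))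
    near? x = ¬? ((x zero ⊝ t) ∣? 1#)
    near-cong : ∀ {c c′} → c ≈ c′ → (p : Dec (¬ Unit (c ⊝ t))) (p′ : Dec (¬ Unit (c′ ⊝ t))) → ⟦ p ⟧ ≡ ⟦ p′ ⟧
    near-cong e = ⟦⟧-cong (λ ¬u u → ¬u (unit-resp (+-congʳ (sym e)) u)) (λ ¬u u → ¬u (unit-resp (+-congʳ e) u))

  -- Induct through a dense level of the first coordinate. There the differences have first entry
  -- zero, so adding a point whose first entry differs from the origin by a unit multiplies the
  -- smaller determinant by that unit.
  large⇒frame : ∀ n {S : List (Vec R n)} → DistinctVecs S → N ^ n < q * length S → Frame S
  large⇒frame zero {[]} dis large = ⊥-elim (ℕ.n≮0 (≡.subst (1 <_) (ℕ.*-zeroʳ q) large))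
  large⇒frame zero {z ∷ S} dis large = record
    { origin = z ; points = λ () ; origin∈ = here ≡.refl ; points∈ = λ () ; unit = ∣-refl }
  large⇒frame (suc n) {S} dis large with large-slice (λ x → x zero) S large
  ... | c , large′ = record
    { origin = origin
    ; points = x ∷ᵛ points
    ; origin∈ = origin∈
    ; points∈ = λ { zero → x∈ ; (suc j) → points∈ j }
    ; unit = unit-resp (sym (det-firstRow M (λ j → trans (+-congʳ (level j)) (-‿inverseʳ _)))) (unit-* u unit) }
    where
    F : SlicedFrame (λ x → x zero) S
    F = lift-frame (λ x → x zero) c S
      (large⇒frame n (slice-distinct (λ x → x zero) (λ { e e′ zero → e ; e e′ (suc i) → e′ i }) c dis) large′)
    open SlicedFrame F
    step = find (unit-step dis large (origin zero))
    x = proj₁ step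
    x∈ = proj₁ (proj₂ step)
    u = proj₂ (proj₂ step)
    M : Fin (suc n) → Vec R (suc n)
    M i j = (x ∷ᵛ points) j i ⊝ origin i

  lin-frame : ∀ a {S : List (Vec R (suc n))} → DistinctVecs S → N ^ suc n < q * length S → SlicedFrame (lin a) S
  lin-frame {n} a {S} dis large with large-slice (lin a) S large
  ... | c , large′ = lift-frame (lin a) c S (large⇒frame n (slice-distinct (lin a) determined c dis) large′)
    where
    determined : ∀ {x y} → lin a x ≈ lin a y → _≈ᵥ_ R (tail x) (tail y) → _≈ᵥ_ R x y
    -- The first coordinate enters `lin a` with coefficient 1, so it can be recovered by cancelling
    -- the rest.
    determined {x} {y} e e′ zero    = +-cancelʳ _ _ _ (trans (+-congˡ (sum-cong (λ i → *-congˡ (sym (e′ i))))) e)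
    determined {x} {y} e e′ (suc i) = e′ i

  -- Volumes pinned at the origin of a frame

  module PinnedVolumes {n} {E : Subset R (suc n)} {a : Vec R n} (F : SlicedFrame (lin a) (pts E)) where
    open SlicedFrame F
    open ≈-Reasoning

    base : Carrier
    base = det R (λ i j → points j (suc i) ⊝ origin (suc i))

    -- After the shear the first row consists of the values of `lin a` on the difference vectors;
    -- these vanish at the frame points, which share the level of the origin.
    volume : ∀ x → detCols R (λ j → _-ᵥ_ R ((x ∷ᵛ points) j) origin) ≈ (lin a x ⊝ lin a origin) ⊗ base
    volume x = begin
      det R M
        ≈⟨ det-shear a M ⟩
      det R ((λ j → lin a (λ i → M i j)) ∷ᵛ λ i → M (suc i))
        ≈⟨ det-firstRow ((λ j → lin a (λ i → M i j)) ∷ᵛ λ i → M (suc i)) (λ j → trans (lin-⊝ a (points j) origin) (x≈y⇒x∙y⁻¹≈ε (level j))) ⟩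
      lin a (_-ᵥ_ R x origin) ⊗ base
        ≈⟨ *-congʳ (lin-⊝ a x origin) ⟩
      (lin a x ⊝ lin a origin) ⊗ base ∎
      where
      M : Fin (suc n) → Vec R (suc n)
      M i j = (x ∷ᵛ points) j i ⊝ origin i

    V? : ∀ c → Dec (V R E origin c)
    V? c = tuples? (suc n) (pts E)
      (λ {f} {g} f≡g e → trans e (det-cong {M = λ i j → f j i ⊝ origin i} {M′ = λ i j → g j i ⊝ origin i} (λ i j → +-congʳ (reflexive (≡.cong (λ v → v i) (f≡g j))))))
      (λ x → c ≟ detCols R (λ i → _-ᵥ_ R (x i) origin))

    V-resp : ∀ {c c′} → c ≈ c′ → V R E origin c → V R E origin c′
    V-resp e (x , x∈ , e′) = x , x∈ , trans (sym e) e′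

    volumes : ℕ
    volumes = ∑[ c ∈ elems ] ⟦ V? c ⟧

    V-size : HasSize R (V R E origin) volumes
    V-size = filter V? elems , length-filter V? elems
      , AllPairsP.filter⁺ V? elems-distinct
      , AllP.all-filter V? elems
      , λ c v → let (c′ , c′∈ , c≈c′) = find (elems-complete c)
                in lose (∈.∈-filter⁺ V? c′∈ (V-resp c≈c′ v)) c≈c′

    -- As `base` is a unit, `φ` is a bijection of the ring; by `volume` it carries values of `lin a`
    -- on `E` to volumes.
    attained≤volumes : (∑[ c ∈ elems ] ⟦ attained? (pts E) a c ⟧) ≤ volumes
    attained≤volumes = ℕ.≤-trans
      (sumOver-mono elems (λ c → ⟦⟧-mono (realise c) (attained? (pts E) a c) (V? (φ c))))
      (ℕ.≤-reflexive (Elt.sumOver-reindex {elems} elems-enumerate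
        (λ {x} {y} e → ⟦⟧-cong (V-resp e) (V-resp (sym e)) (V? x) (V? y)) φ ψ φ⇒ψ ψ⇒φ))
      where
      o = lin a origin
      base⁻¹ = proj₁ unit
      base-inverse : base ⊗ base⁻¹ ≈ 1#
      base-inverse = trans (*-comm _ _) (sym (proj₂ unit))
      φ ψ : Carrier → Carrier
      φ c = (c ⊝ o) ⊗ base
      ψ y = y ⊗ base⁻¹ ⊕ o
      φ⇒ψ : ∀ {x y} → φ x ≈ y → ψ y ≈ x
      φ⇒ψ {x} {y} e = begin
        y ⊗ base⁻¹ ⊕ o                     ≈⟨ +-congʳ (*-congʳ e) ⟨
        (x ⊝ o) ⊗ base ⊗ base⁻¹ ⊕ o        ≈⟨ +-congʳ (trans (*-assoc _ _ _) (trans (*-congˡ base-inverse) (*-identityʳ _))) ⟩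
        (x ⊝ o) ⊕ o                        ≈⟨ trans (+-assoc x (⊖ o) o) (trans (+-congˡ (-‿inverseˡ o)) (+-identityʳ x)) ⟩
        x                                  ∎
      ψ⇒φ : ∀ {x y} → ψ y ≈ x → φ x ≈ y
      ψ⇒φ {x} {y} e = begin
        (x ⊝ o) ⊗ base                     ≈⟨ *-congʳ (+-congʳ e) ⟨
        (y ⊗ base⁻¹ ⊕ o ⊝ o) ⊗ base        ≈⟨ *-congʳ (trans (+-assoc _ o (⊖ o)) (trans (+-congˡ (-‿inverseʳ o)) (+-identityʳ _))) ⟩
        y ⊗ base⁻¹ ⊗ base                  ≈⟨ trans (*-assoc _ _ _) (trans (*-congˡ (sym (proj₂ unit))) (*-identityʳ y)) ⟩
        y                                  ∎
      realise : ∀ c → Any (λ x → lin a x ≈ c) (pts E) → V R E origin (φ c)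
      realise c x∈E with find x∈E
      ... | x , x∈ , e = (x ∷ᵛ points) , (λ { zero → x∈ ; (suc j) → points∈ j })
        , trans (*-congʳ (+-congʳ (sym e))) (sym (volume x))

  -- Few collisions force many values of `lin a`, by `attained*collisions`; the frame turns these
  -- values into equally many volumes.
  many-volumes : ∀ m {E : Subset R (suc n)} {a} → 0 < size R E → SlicedFrame (lin a) (pts E) →
    m * (N * collisions (pts E) a) ≤ suc m * (size R E * size R E) →
    Σ (Vec R (suc n)) λ z → z ∈ pts E × Σ ℕ λ k → HasSize R (V R E z) k × m * N ≤ suc m * k
  many-volumes m {E} {a} 0<L F few = SlicedFrame.origin F , SlicedFrame.origin∈ F , volumes , V-size ,
    ℕ.≤-trans (cancel (collisions (pts E) a) few (attained*collisions (pts E) a))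
      (ℕ.*-monoʳ-≤ (suc m) attained≤volumes)
    where
    open ℕ.≤-Reasoning
    open PinnedVolumes {E = E} F
    L = size R E
    image = ∑[ c ∈ elems ] ⟦ attained? (pts E) a c ⟧
    cancel : ∀ C → m * (N * C) ≤ suc m * (L * L) → L * L ≤ image * C → m * N ≤ suc m * image
    -- Dividing by the number of collisions needs it to be positive; zero would contradict `L * L`
    -- being positive.
    cancel zero    _   L²≤ = ⊥-elim (ℕ.<⇒≱ (ℕ.*-mono-< 0<L 0<L) (≡.subst (L * L ≤_) (ℕ.*-zeroʳ image) L²≤))
    cancel (suc C) few L²≤ = ℕ.*-cancelʳ-≤ (m * N) (suc m * image) (suc C) (begin
      m * N * suc C              ≡⟨ ℕ.*-assoc m N (suc C) ⟩
      m * (N * suc C)            ≤⟨ few ⟩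
      suc m * (L * L)            ≤⟨ ℕ.*-monoʳ-≤ (suc m) L²≤ ⟩
      suc m * (image * suc C)    ≡⟨ ℕ.*-assoc (suc m) image (suc C) ⟨
      suc m * image * suc C      ∎)

  pinned : 2 ≤ q → 1 ≤ r → ∀ m e (E : Subset R (2 + e)) →
    suc m * (suc r * N ^ (2 + e)) ≤ q * size R E →
    Σ (Vec R (2 + e)) λ z → z ∈ pts E × Σ ℕ λ n → HasSize R (V R E z) n × m * N ≤ suc m * n
  pinned 2≤q 1≤r m e E large =
    let (a , few) = good-direction 2≤q m e (distinct E) large
    in many-volumes m {E} (nonempty (size R E) dense) (lin-frame a (distinct E) dense) few
    where
    open ℕ.≤-Reasoning
    N^d>0 : 0 < N ^ (2 + e)
    N^d>0 = ℕ.m^n>0 N {{ℕ.m^n≢0 q r {{>-nonZero (ℕ.<-trans (s≤s z≤n) 2≤q)}}}} (2 + e)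
    nonempty : ∀ L → N ^ (2 + e) < q * L → 0 < L
    nonempty zero    h = ⊥-elim (ℕ.n≮0 (≡.subst (N ^ (2 + e) <_) (ℕ.*-zeroʳ q) h))
    nonempty (suc L) h = s≤s z≤n
    -- The factor `suc r` is at least 2; this yields the strict inequality that the pigeonhole
    -- argument for frames needs.
    doubled : ∀ {X} → 0 < X → X < suc m * (suc r * X)
    doubled {X} 0<X = begin-strict
      X                     <⟨ ℕ.m<m+n X 0<X ⟩
      X + X                 ≡⟨ ≡.cong (X +_) (ℕ.+-identityʳ X) ⟨
      2 * X                 ≤⟨ ℕ.*-monoˡ-≤ X (s≤s 1≤r) ⟩
      suc r * X             ≤⟨ ℕ.m≤m+n _ _ ⟩
      suc m * (suc r * X)   ∎
    dense : N ^ (2 + e) < q * size R E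
    dense = ℕ.<-≤-trans (doubled N^d>0) large

-- The asymptotic statement

density-bound : ∀ m r e q L → 1 ≤ r →
  (suc m * suc r) * (q ^ (r ∸ 1) * q ^ (r * (suc e))) ≤ L → suc m * (suc r * (q ^ r) ^ (2 + e)) ≤ q * L
-- In the hypothesis stands `N^d / q`, written without division; multiplying by `q` restores `N^d`.
density-bound m (suc r) e q L _ h = begin
  suc m * (suc (suc r) * (q * q ^ r * (q ^ suc r) ^ suc e))
    ≡⟨ ≡.cong (λ P → suc m * (suc (suc r) * (q * q ^ r * P))) (ℕ.^-*-assoc q (suc r) (suc e)) ⟩
  suc m * (suc (suc r) * (q * q ^ r * q ^ (suc r * suc e)))
    ≡⟨ solve 5 (λ a b q x y → a :* (b :* (q :* x :* y)) := q :* (a :* b :* (x :* y))) ≡.refl (suc m) (suc (suc r)) q (q ^ r) (q ^ (suc r * suc e)) ⟩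
  q * (suc m * suc (suc r) * (q ^ r * q ^ (suc r * suc e)))
    ≤⟨ ℕ.*-monoʳ-≤ q h ⟩
  q * L ∎
  where
  open ℕ.≤-Reasoning
  open +-*-Solver

-- Both asymptotic notions are unfolded: for every `m` there are a density constant and a threshold
-- for `q`, depending only on `d`, `r` and `m`, beyond which at least the fraction `m / (m + 1)` of
-- the ring is attained.
theorem1p4 : (d r : ℕ) → 2 ≤ d → 1 ≤ r →
    (m : ℕ) → Σ ℕ λ K → Σ ℕ λ Q →
    (R : CommutativeRing 0ℓ 0ℓ) (q : ℕ) → OddPrimePower q → Q ≤ q →
    IsFiniteValuationRing R q r →
    (E : Subset R d) →
    K * (q ^ (r ∸ 1) * q ^ (r * (d ∸ 1))) ≤ size R E →
    Σ (Vec R d) λ z → z ∈ pts E × Σ ℕ λ n →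
    HasSize R (V R E z) n × m * q ^ r ≤ suc m * n
-- In `K`, the factor `suc m` pays for the accuracy and `suc r` for the number of powers of the
-- uniformiser; `Q = 2` supplies `2 ≤ q`.
theorem1p4 (suc (suc e)) r (s≤s (s≤s _)) 1≤r m = suc m * suc r , 2 , λ R q _ 2≤q fvr E large →
  FiniteValuationRing.pinned R q r fvr 2≤q 1≤r m e E (density-bound m r e q (size R E) 1≤r large)
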